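{- Let $\Phi=\phi_1\wedge\cdots\wedge\phi_m$ with $\Pr_{\mathcal D}(\Phi)>0$, and let $\sim$ be a dependency relation for $\Phi$ satisfying Axioms 1 and 2. Then Algorithm $\mathrm{PRS}_f(\Phi,\mathcal D)$ with limited nondeterminism terminates with probability $1$, for any choice function $f$. On termination, $\mathbf X$ is distributed according to $\mathcal D_\Phi$, the distribution $\mathcal D$ conditioned on $\Phi(\mathbf X)$.
   Context: Setting: For $i\in[n]$, $X_i$ takes values in a countable set $D_i$ with probability distribution $\mathcal D_i$; $\mathcal D=\prod_i\mathcal D_i$ is the product distribution. $\Phi=\phi_1\wedge\cdots\wedge\phi_m$, where clause $\phi_k$ is a Boolean function of the variables with indices in its nonempty scope $\mathrm{Scp}(\phi_k)\subseteq[n]$. A dependency relation is a symmetric relation $\sim$ on pairs of distinct elements of $[m]$ such that $k\sim\ell$ implies $\mathrm{Scp}(\phi_k)\cap\mathrm{Scp}(\phi_\ell)\ne\emptyset$. The converse need not hold. Axiom 1: if $k\sim\ell$, then $\phi_k\vee\phi_\ell$ is true under every assignment. Axiom 2: let $k\ne\ell$ with $k\not\sim\ell$, let $\mathbf x$ be an assignment under which both $\phi_k$ and $\phi_\ell$ are false, and let $\mathbf x'$ be any assignment agreeing with $\mathbf x$ outside $\mathrm{Scp}(\phi_\ell)$. Then there is some $k'\in[m]$ with $\mathrm{Scp}(\phi_{k'})\supseteq\mathrm{Scp}(\phi_k)$ and $\phi_{k'}$ false under $\mathbf x'$. Algorithm $\mathrm{PRS}_f(\Phi,\mathcal D)$: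 fix a function $f$ that assigns to each nonempty $N\subseteq[m]$ an element $f(N)\in N$. Sample $\mathbf X$ from $\mathcal D$. While $\Phi(\mathbf X)$ is false, let $N=\{\ell:\phi_\ell\text{ is false under the current }\mathbf X\}$, let $k=f(N)$, and resample all $X_i$, $i\in\mathrm{Scp}(\phi_k)$, independently from $\mathcal D_i$. -}

module Defs where

open import Level using (0ℓ)
open import Data.Bool.Base using (Bool; true; false; not; _∧_; _∨_; if_then_else_)
open import Data.Fin.Base using (Fin)
open import Data.Fin.Subset using (Subset; Nonempty; _∈_; _∉_; _⊆_; _∩_)
open import Data.Fin.Subset.Properties using (_∈?_; nonempty?)
open import Data.List.Base as List using (List; []; _∷_)
open import Data.List.Relation.Unary.AllPairs.Core using ([])
open import Data.List.Relation.Unary.Unique.Setoid using (Unique)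
open import Data.Nat.Base using (ℕ; zero; suc)
import Data.Nat.Properties as ℕ
open import Data.Product.Base using (_×_; _,_; ∃; ∃₂; ∃-syntax)
open import Data.Rational.Base as ℚ using (ℚ; 0ℚ; 1ℚ)
import Data.Rational.Properties as ℚ
open import Data.Sum.Base using (_⊎_; inj₁; inj₂)
open import Data.Vec.Base as Vec using ()
import Data.Vec.Functional as Vector
open import Function.Bundles using (_↣_)
open import Relation.Binary.Bundles using (Setoid)
open import Relation.Binary.Core using (Rel)
open import Relation.Binary.Definitions using (Symmetric; DecidableEquality)
open import Relation.Binary.PropositionalEquality
  using (_≡_; _≢_; refl; sym; trans; cong; subst; setoid)
open import Relation.Nullary using (does; yes; no; ¬_)
open import Relation.Nullary.Decidable using (via-injection)

-- Probabilities take values in [0,∞], represented by lower Dedekind cuts: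
-- "Below x q" means q < x.  The cut of ∞ is all of ℚ.  Lower cuts give every
-- countable sum of non-negative terms a value with no convergence condition.
-- A value that, added to another one, gives 1 is automatically located, i.e.
-- an ordinary real number; this covers all masses of a probability
-- distribution on a set with decidable equality.

record ℝ≥0∞ : Set₁ where
  field
    Below    : ℚ → Set
    negative : ∀ {q} → q ℚ.< 0ℚ → Below q
    down     : ∀ {q r} → q ℚ.< r → Below r → Below q
    rounded  : ∀ {q} → Below q → ∃[ r ] q ℚ.< r × Below r

open ℝ≥0∞ public

infix 4 _≈_
_≈_ : ℝ≥0∞ → ℝ≥0∞ → Set
x ≈ y = (∀ q → Below x q → Below y q) × (∀ q → Below y q → Below x q)

Positive : ℝ≥0∞ → Set
Positive x = Below x 0ℚ

fromℚ : (q : ℚ) → 0ℚ ℚ.≤ q → ℝ≥0∞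
fromℚ q 0≤q = record
  { Below    = ℚ._< q
  ; negative = λ r<0 → ℚ.<-≤-trans r<0 0≤q
  ; down     = ℚ.<-trans
  ; rounded  = ℚ.<-dense
  }

𝟘 𝟙 : ℝ≥0∞
𝟘 = fromℚ 0ℚ ℚ.≤-refl
𝟙 = fromℚ 1ℚ (ℚ.nonNegative⁻¹ 1ℚ)

split-negative : ∀ {q} → q ℚ.< 0ℚ →
  ∃₂ λ r s → r ℚ.< 0ℚ × s ℚ.< 0ℚ × q ℚ.< r ℚ.+ s
split-negative {q} q<0 =
  let (r , q<r , r<0) = ℚ.<-dense q<0
      (l , q<l , l<r) = ℚ.<-dense q<r
      s               = ℚ.- r ℚ.+ l
      r+s≡l : r ℚ.+ s ≡ l
      r+s≡l = trans (sym (ℚ.+-assoc r (ℚ.- r) l))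
                (trans (cong (ℚ._+ l) (ℚ.+-inverseʳ r)) (ℚ.+-identityˡ l))
      s<0   = subst (s ℚ.<_) (ℚ.+-inverseˡ r) (ℚ.+-monoʳ-< (ℚ.- r) l<r)
  in r , s , r<0 , s<0 , subst (q ℚ.<_) (sym r+s≡l) q<l

infixl 6 _⊕_
infixl 7 _⊗_ _⊘_

_⊕_ : ℝ≥0∞ → ℝ≥0∞ → ℝ≥0∞
x ⊕ y = record
  { Below    = λ q → ∃₂ λ r s → Below x r × Below y s × q ℚ.< r ℚ.+ s
  ; negative = λ q<0 →
      let (r , s , r<0 , s<0 , q<r+s) = split-negative q<0
      in r , s , negative x r<0 , negative y s<0 , q<r+s
  ; down     = λ { q<q′ (r , s , r<x , s<y , q′<) → r , s , r<x , s<y , ℚ.<-trans q<q′ q′< }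
  ; rounded  = λ { (r , s , r<x , s<y , q<) →
      let (m , q<m , m<) = ℚ.<-dense q< in m , q<m , r , s , r<x , s<y , m< }
  }

_⊗_ : ℝ≥0∞ → ℝ≥0∞ → ℝ≥0∞
x ⊗ y = record
  { Below    = λ q → q ℚ.< 0ℚ ⊎ ∃₂ λ r s →
      0ℚ ℚ.≤ r × 0ℚ ℚ.≤ s × Below x r × Below y s × q ℚ.< r ℚ.* s
  ; negative = inj₁
  ; down     = λ where
      q<q′ (inj₁ q′<0) → inj₁ (ℚ.<-trans q<q′ q′<0)
      q<q′ (inj₂ (r , s , 0≤r , 0≤s , r<x , s<y , q′<)) →
        inj₂ (r , s , 0≤r , 0≤s , r<x , s<y , ℚ.<-trans q<q′ q′<)
  ; rounded  = λ where
      (inj₁ q<0) → let (m , q<m , m<0) = ℚ.<-dense q<0 in m , q<m , inj₁ m<0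
      (inj₂ (r , s , 0≤r , 0≤s , r<x , s<y , q<)) →
        let (m , q<m , m<) = ℚ.<-dense q<
        in m , q<m , inj₂ (r , s , 0≤r , 0≤s , r<x , s<y , m<)
  }

-- For q ≥ 0: q < x / y iff some q′ > q satisfies q′ · y < x.
_⊘_ : ℝ≥0∞ → ℝ≥0∞ → ℝ≥0∞
x ⊘ y = record
  { Below    = λ q → q ℚ.< 0ℚ ⊎ ∃₂ λ q′ r →
      q ℚ.< q′ × Below x r × (∀ s → Below y s → q′ ℚ.* s ℚ.≤ r)
  ; negative = inj₁
  ; down     = λ where
      p<q (inj₁ q<0) → inj₁ (ℚ.<-trans p<q q<0)
      p<q (inj₂ (q′ , r , q<q′ , r<x , q′y≤r)) →
        inj₂ (q′ , r , ℚ.<-trans p<q q<q′ , r<x , q′y≤r)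
  ; rounded  = λ where
      (inj₁ q<0) → let (m , q<m , m<0) = ℚ.<-dense q<0 in m , q<m , inj₁ m<0
      (inj₂ (q′ , r , q<q′ , r<x , q′y≤r)) →
        let (m , q<m , m<q′) = ℚ.<-dense q<q′
        in m , q<m , inj₂ (q′ , r , m<q′ , r<x , q′y≤r)
  }

⨆ : (ℕ → ℝ≥0∞) → ℝ≥0∞
⨆ x = record
  { Below    = λ q → ∃[ t ] Below (x t) q
  ; negative = λ q<0 → 0 , negative (x 0) q<0
  ; down     = λ { q<r (t , r<x) → t , down (x t) q<r r<x }
  ; rounded  = λ { (t , q<x) → let (r , q<r , r<x) = rounded (x t) q<x in r , q<r , t , r<x }
  }

⟦_⟧ : Bool → ℝ≥0∞
⟦ b ⟧ = if b then 𝟙 else 𝟘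

∏ : ∀ {n} → (Fin n → ℝ≥0∞) → ℝ≥0∞
∏ = Vector.foldr _⊗_ 𝟙

-- Unordered sum: the supremum of the sums over finite repetition-free lists.

∑ : (S : Setoid 0ℓ 0ℓ) → (Setoid.Carrier S → ℝ≥0∞) → ℝ≥0∞
∑ S g = record
  { Below    = λ q → ∃[ l ] Unique S l × Below (listSum l) q
  ; negative = λ q<0 → [] , [] , q<0
  ; down     = λ { q<r (l , u , r<) → l , u , down (listSum l) q<r r< }
  ; rounded  = λ { (l , u , q<) →
      let (r , q<r , r<) = rounded (listSum l) q< in r , q<r , l , u , r< }
  }
  where
  listSum : List (Setoid.Carrier S) → ℝ≥0∞
  listSum l = List.foldr _⊕_ 𝟘 (List.map g l)

record Distribution (A : Set) : Set₁ where
  field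
    mass  : A → ℝ≥0∞
    total : ∑ (setoid A) mass ≈ 𝟙

open Distribution public

record Instance (n m : ℕ) : Set₁ where
  field
    D         : Fin n → Set
    countable : ∀ i → D i ↣ ℕ
    dist      : ∀ i → Distribution (D i)

  Assignment : Set
  Assignment = ∀ i → D i

  field
    clause       : Fin m → Assignment → Bool
    Scp          : Fin m → Subset n
    Scp-nonempty : ∀ k → Nonempty (Scp k)
    clause-local : ∀ k (x y : Assignment) → (∀ i → i ∈ Scp k → x i ≡ y i) →
                   clause k x ≡ clause k y

  infix 4 _≐_
  _≐_ : Rel Assignment 0ℓ
  x ≐ y = ∀ i → x i ≡ y i

  -- Pointwise equality, since function extensionality is not available.
  assignments : Setoid 0ℓ 0ℓ
  assignments = record
    { Carrier       = Assignment
    ; _≈_           = _≐_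
    ; isEquivalence = record
      { refl  = λ _ → refl
      ; sym   = λ p i → sym (p i)
      ; trans = λ p q i → trans (p i) (q i)
      }
    }

  _≟_ : ∀ {i} → DecidableEquality (D i)
  _≟_ {i} = via-injection (countable i) ℕ._≟_

  Mass : Set₁
  Mass = Assignment → ℝ≥0∞

  Pr : Mass → (Assignment → Bool) → ℝ≥0∞
  Pr μ A = ∑ assignments λ x → μ x ⊗ ⟦ A x ⟧

  𝒟 : Mass
  𝒟 x = ∏ λ i → mass (dist i) (x i)

  Φ : Assignment → Bool
  Φ x = List.and (List.tabulate λ k → clause k x)

  𝒟-given-Φ : (Assignment → Bool) → ℝ≥0∞
  𝒟-given-Φ A = Pr 𝒟 (λ x → A x ∧ Φ x) ⊘ Pr 𝒟 Φ

  violated : Assignment → Subset m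
  violated x = Vec.tabulate λ k → not (clause k x)

  dirac : Assignment → Mass
  dirac x y = ∏ λ i → ⟦ does (x i ≟ y i) ⟧

  resample : Subset n → Assignment → Mass
  resample S x y = ∏ λ i →
    if does (i ∈? S) then mass (dist i) (y i) else ⟦ does (x i ≟ y i) ⟧

-- The nonemptiness proof is irrelevant, so the chosen index depends on N alone.
record Choice (m : ℕ) : Set where
  field
    choose   : (N : Subset m) → .(Nonempty N) → Fin m
    choose-∈ : ∀ N .(ne : Nonempty N) → choose N ne ∈ N

open Choice public

module _ {n m} (I : Instance n m) (f : Choice m) where
  open Instance I

  -- One iteration of the loop; satisfying assignments are absorbing.
  step : Assignment → Mass
  step x with nonempty? (violated x)
  ... | yes ne = resample (Scp (choose f (violated x) ne)) x
  ... | no  _  = dirac x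

  law : ℕ → Mass
  law zero    = 𝒟
  law (suc t) y = ∑ assignments λ x → law t x ⊗ step x y

  -- Probability that the loop is ever exited, with an output satisfying A: the
  -- events "exited within t iterations with output in A" increase with t.
  PrOutput : (Assignment → Bool) → ℝ≥0∞
  PrOutput A = ⨆ λ t → Pr (law t) λ x → A x ∧ Φ x

  PrTerminates : ℝ≥0∞
  PrTerminates = PrOutput λ _ → true

module _ {n m} (I : Instance n m) (_∼_ : Rel (Fin m) 0ℓ) where
  open Instance I

  record IsDependencyRelation : Set where
    field
      symmetric   : Symmetric _∼_
      distinct    : ∀ {k ℓ} → k ∼ ℓ → k ≢ ℓ
      scopes-meet : ∀ {k ℓ} → k ∼ ℓ → Nonempty (Scp k ∩ Scp ℓ)

  Axiom1 : Set
  Axiom1 = ∀ k ℓ → k ∼ ℓ → ∀ x → clause k x ∨ clause ℓ x ≡ true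

  Axiom2 : Set
  Axiom2 = ∀ k ℓ → k ≢ ℓ → ¬ (k ∼ ℓ) →
    ∀ x x′ → clause k x ≡ false → clause ℓ x ≡ false →
    (∀ i → i ∉ Scp ℓ → x i ≡ x′ i) →
    ∃[ k′ ] Scp k ⊆ Scp k′ × clause k′ x′ ≡ false

{-# OPTIONS --safe #-}

-- Let each iteration draw a fresh sample of all variables and use only its coordinates in the
-- resampled scope; a run of t iterations is then a function of t + 1 independent samples. Exchange
-- the final state, coordinate by coordinate, with one further sample. If both satisfy Φ, the
-- exchanged run violates the same clauses at every time: by Axioms 1 and 2, a violated clause with
-- a variable that is never resampled again would leave a violated clause at the end. So the
-- exchange is a weight-preserving involution, and Pr(X_t ∈ A ∩ Φ) Pr(Φ) = Pr(X_t ∈ Φ) Pr(A ∩ Φ).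
--
-- For termination, fix z satisfying Φ with 𝒟 z > 0. When the next n samples all equal z, the run
-- reaches Φ from any state, since each iteration removes a disagreement with z.

module Submission where

open import Algebra.Bundles using (CommutativeSemiring)
import Algebra.Properties.CommutativeMonoid.Sum as Sum
import Algebra.Properties.CommutativeSemigroup as CommutativeSemigroupProperties
open import Data.Bool.Base using (Bool; true; false; if_then_else_; not; _∧_; _∨_)
open import Data.Bool.ListAction using (and)
import Data.Bool.Properties as Bool
import Data.Empty
open import Data.Fin.Base using (Fin; zero; suc)
import Data.Fin.Properties as Fin
open import Data.Fin.Subset using (Subset; _∈_; _∉_; _⊆_; _⊂_; ⊥; ∣_∣)
open import Data.Fin.Subset.Properties using (_∈?_; nonempty?; ∉⊥; p⊂q⇒∣p∣<∣q∣; ∣p∣≤n)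
import Data.Integer.Base as ℤ
import Data.Integer.Properties as ℤ
open import Data.Integer.Tactic.RingSolver using (solve-∀)
open import Data.List.Base as List
  using (List; []; _∷_; _++_; map; foldr; deduplicate; cartesianProduct)
import Data.List.Membership.Setoid.Properties as Membership
open import Data.List.Relation.Unary.All as All using (All; []; _∷_)
import Data.List.Relation.Unary.All.Properties as All
open import Data.List.Relation.Unary.AllPairs using ([]; _∷_)
import Data.List.Relation.Unary.AllPairs.Properties as AllPairs
open import Data.List.Relation.Unary.Any using (here; there)
open import Data.List.Relation.Unary.Unique.DecSetoid.Properties using (deduplicate-!)
open import Data.List.Relation.Unary.Unique.Setoid using (Unique)
import Data.List.Relation.Unary.Unique.Setoid.Properties as Unique
open import Data.Nat.Base as ℕ using (ℕ; zero; suc; s≤s)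
import Data.Nat.Properties as ℕ
open import Data.Product.Base using (_×_; _,_; ∃-syntax; proj₁; proj₂; swap)
open import Data.Product.Relation.Binary.Pointwise.NonDependent using (_×ₛ_)
open import Data.Rational.Base as ℚ using (ℚ; mkℚ; 0ℚ; 1ℚ; toℚᵘ)
import Data.Rational.Properties as ℚ
open import Data.Rational.Solver using (module +-*-Solver)
import Data.Rational.Unnormalised.Base as ℚᵘ
import Data.Rational.Unnormalised.Properties as ℚᵘ
open import Data.Sum.Base using (_⊎_; inj₁; inj₂)
open import Data.Unit.Base using (⊤; tt)
import Data.Vec.Base as Vec
import Data.Vec.Functional as Vector
import Data.Vec.Properties as Vec
open import Function.Base using (_∘_)
open import Level using (0ℓ) renaming (suc to lsuc)
open import Relation.Binary.Bundles using (Setoid; DecSetoid; Poset)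
open import Relation.Binary.Core using (Rel; _Preserves_⟶_)
open import Relation.Binary.Definitions using (Decidable; DecidableEquality)
open import Relation.Binary.PropositionalEquality as ≡ using (_≡_; _≢_; setoid)
import Relation.Binary.Reasoning.PartialOrder as PartialOrderReasoning
import Relation.Binary.Reasoning.Setoid as SetoidReasoning
open import Relation.Binary.Structures using (IsPartialOrder; IsEquivalence)
open import Relation.Nullary using (Dec; does; yes; no; ¬_; contradiction)
open import Relation.Nullary.Decidable using (_×-dec_; dec-true; dec-false)
import Relation.Unary as Unary

-- The choice function reads the entire violated set, so the exchanged run follows the original one
-- as soon as these sets agree at every time, whatever `f` is. The danger is circularity:
-- persistence of violations would have to be applied to the exchanged run before that run is known
-- to resample the same scopes. The induction therefore measures the violations of exchanged states
-- against the scopes resampled in the original run.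
--
-- Such draws contribute nothing to either side, so an injection on the good draws suffices for an
-- inequality, and symmetry gives the other one. The identity stays multiplied out until the limit
-- is taken: [0,∞] has no subtraction, and division by a lower cut behaves well only if the cut is
-- located. For this reason the complement of a probability always appears as a second summand
-- completing it to 1.

Πₛ : ∀ {n} → (Fin n → Set) → Setoid 0ℓ 0ℓ
Πₛ D = record
  { Carrier       = ∀ i → D i
  ; _≈_           = λ x y → ∀ i → x i ≡ y i
  ; isEquivalence = record
    { refl  = λ _ → ≡.refl
    ; sym   = λ p i → ≡.sym (p i)
    ; trans = λ p q i → ≡.trans (p i) (q i)
    }
  }

-- Ordered semirings with unordered infinite sums

record ∑-Semiring : Set₂ where
  field
    commutativeSemiring : CommutativeSemiring (lsuc 0ℓ) 0ℓ
  open CommutativeSemiring commutativeSemiring public hiding (setoid; zero)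

  listSum : ∀ {A : Set} → List A → (A → Carrier) → Carrier
  listSum l g = foldr _+_ 0# (map g l)

  infix 4 _≤_
  field
    _≤_              : Rel Carrier 0ℓ
    ≤-isPartialOrder : IsPartialOrder _≈_ _≤_
    0≤               : ∀ x → 0# ≤ x
    +-mono           : ∀ {w x y z} → w ≤ x → y ≤ z → w + y ≤ x + z
    *-mono           : ∀ {w x y z} → w ≤ x → y ≤ z → w * y ≤ x * z
    ∑                : (S : Setoid 0ℓ 0ℓ) → (Setoid.Carrier S → Carrier) → Carrier
    ∑-upper          : ∀ S g {l} → Unique S l → listSum l g ≤ ∑ S g
    -- Sums are suprema of finite sums, and affine maps preserve these suprema.
    ∑-least          : ∀ S g {a b y} → (∀ l → Unique S l → a * listSum l g + b ≤ y) → a * ∑ S g + b ≤ y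

  ≤-poset : Poset (lsuc 0ℓ) 0ℓ 0ℓ
  ≤-poset = record { isPartialOrder = ≤-isPartialOrder }

  open IsPartialOrder ≤-isPartialOrder public using ()
    renaming (refl to ≤-refl; reflexive to ≤-reflexive; trans to ≤-trans; antisym to ≤-antisym)

module Summation (R : ∑-Semiring) where
  open ∑-Semiring R
  open PartialOrderReasoning ≤-poset
  open CommutativeSemigroupProperties +-commutativeSemigroup using ()
    renaming (interchange to +-interchange; x∙yz≈y∙xz to x+yz≈y+xz)

  listSum-mono : ∀ {A : Set} (l : List A) {g h} → (∀ s → g s ≤ h s) → listSum l g ≤ listSum l h
  listSum-mono []      g≤h = ≤-refl
  listSum-mono (s ∷ l) g≤h = +-mono (g≤h s) (listSum-mono l g≤h)

  listSum-++ : ∀ {A : Set} (k l : List A) {g} → listSum (k ++ l) g ≈ listSum k g + listSum l g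
  listSum-++ []      l     = sym (+-identityˡ _)
  listSum-++ (s ∷ k) l {g} = begin-equality
    g s + listSum (k ++ l) g              ≈⟨ +-congˡ (listSum-++ k l) ⟩
    g s + (listSum k g + listSum l g)     ≈⟨ +-assoc _ _ _ ⟨
    (g s + listSum k g) + listSum l g     ∎

  listSum-map : ∀ {A B : Set} (f : A → B) (l : List A) {g} → listSum (map f l) g ≈ listSum l (g ∘ f)
  listSum-map f []      = refl
  listSum-map f (s ∷ l) = +-congˡ (listSum-map f l)

  listSum-* : ∀ {A : Set} (l : List A) {g} c → listSum l (λ s → c * g s) ≈ c * listSum l g
  listSum-* []      c = sym (zeroʳ c)
  listSum-* (s ∷ l) c = trans (+-congˡ (listSum-* l c)) (sym (distribˡ c _ _))

  listSum-+ : ∀ {A : Set} (l : List A) {g h} → listSum l (λ s → g s + h s) ≈ listSum l g + listSum l h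
  listSum-+ []      = sym (+-identityˡ 0#)
  listSum-+ (s ∷ l) = trans (+-congˡ (listSum-+ l)) (+-interchange _ _ _ _)

  listSum-cartesian : ∀ {A B : Set} (k : List A) (l : List B) {g} →
    listSum (cartesianProduct k l) g ≈ listSum k (λ s → listSum l (λ t → g (s , t)))
  listSum-cartesian []      l = refl
  listSum-cartesian (s ∷ k) l = trans (listSum-++ (map (s ,_) l) (cartesianProduct k l))
    (+-cong (listSum-map (s ,_) l) (listSum-cartesian k l))

  module _ (S : Setoid 0ℓ 0ℓ) where
    open Setoid S using () renaming (Carrier to A; _≈_ to _≈ₛ_)

    ∑-least₀ : ∀ {g y} → (∀ l → Unique S l → listSum l g ≤ y) → ∑ S g ≤ y
    ∑-least₀ {g} {y} bound = begin
      ∑ S g            ≈⟨ trans (+-identityʳ _) (*-identityˡ _) ⟨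
      1# * ∑ S g + 0#  ≤⟨ ∑-least S g (λ l l! →
                            ≤-trans (≤-reflexive (trans (+-identityʳ _) (*-identityˡ _))) (bound l l!)) ⟩
      y                ∎

    ∑-mono : ∀ {g h} → (∀ s → g s ≤ h s) → ∑ S g ≤ ∑ S h
    ∑-mono g≤h = ∑-least₀ λ l l! → ≤-trans (listSum-mono l g≤h) (∑-upper S _ l!)

    ∑-cong : ∀ {g h} → (∀ s → g s ≈ h s) → ∑ S g ≈ ∑ S h
    ∑-cong g≈h = ≤-antisym (∑-mono (≤-reflexive ∘ g≈h)) (∑-mono (≤-reflexive ∘ sym ∘ g≈h))

    ∑-term : ∀ g s → g s ≤ ∑ S g
    ∑-term g s = ≤-trans (≤-reflexive (sym (+-identityʳ (g s)))) (∑-upper S g ([] ∷ []))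

    ∑-*ˡ : ∀ g c → c * ∑ S g ≈ ∑ S (λ s → c * g s)
    ∑-*ˡ g c = ≤-antisym
      (≤-trans (≤-reflexive (sym (+-identityʳ _))) (∑-least S g λ l l! → begin
        c * listSum l g + 0#        ≈⟨ +-identityʳ _ ⟩
        c * listSum l g             ≈⟨ listSum-* l c ⟨
        listSum l (λ s → c * g s)   ≤⟨ ∑-upper S _ l! ⟩
        ∑ S (λ s → c * g s)         ∎))
      (∑-least₀ λ l l! → ≤-trans (≤-reflexive (listSum-* l c)) (*-mono ≤-refl (∑-upper S g l!)))

    ∑-*ʳ : ∀ g c → ∑ S g * c ≈ ∑ S (λ s → g s * c)
    ∑-*ʳ g c = trans (*-comm _ c) (trans (∑-*ˡ g c) (∑-cong λ s → *-comm c (g s)))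

    ∑-singleton : ∀ {g} → g Preserves _≈ₛ_ ⟶ _≈_ → ∀ x → (∀ s → s ≈ₛ x) → ∑ S g ≈ g x
    ∑-singleton {g} g-cong x ≈x = ≤-antisym (∑-least₀ bound) (∑-term g x)
      where
      bound : ∀ l → Unique S l → listSum l g ≤ g x
      bound []          _                     = 0≤ _
      bound (s ∷ [])    _                     = ≤-reflexive (trans (+-identityʳ _) (g-cong (≈x s)))
      bound (s ∷ t ∷ _) ((s≉t ∷ _) ∷ _) =
        contradiction (Setoid.trans S (≈x s) (Setoid.sym S (≈x t))) s≉t

    open import Data.List.Membership.Setoid S using () renaming (_∈_ to _∈ₗ_)

    -- The membership proof locates an entry of `l` equal to `s`, which is pulled out to the front.
    -- The rest `l′` still contains all members of `l` that differ from `s`.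
    insert : ∀ {g} → g Preserves _≈ₛ_ ⟶ _≈_ → ∀ {s l} → s ∈ₗ l →
      ∃[ l′ ] listSum l g ≈ g s + listSum l′ g × (∀ {t} → t ∈ₗ l → ¬ s ≈ₛ t → t ∈ₗ l′)
    insert g-cong {s} {x ∷ l} (here s≈x) = l , +-congʳ (sym (g-cong s≈x)) , λ where
      (here t≈x)  s≉t → contradiction (Setoid.trans S s≈x (Setoid.sym S t≈x)) s≉t
      (there t∈l) s≉t → t∈l
    insert g-cong {s} {x ∷ l} (there s∈l) =
      let (l′ , eq , keep) = insert g-cong s∈l
      in x ∷ l′ , trans (+-congˡ eq) (x+yz≈y+xz _ _ _) , λ where
        (here t≈x)  s≉t → here t≈x
        (there t∈l) s≉t → there (keep t∈l s≉t)

    -- Each entry of `k` is cancelled against an entry of `l`. As `k` has no repetitions, its later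
    -- entries survive this removal; what is left of `l` at the end contributes a nonnegative
    -- amount.
    listSum-⊆ : ∀ {g} → g Preserves _≈ₛ_ ⟶ _≈_ → ∀ {k l} → Unique S k → (∀ {s} → s ∈ₗ k → s ∈ₗ l) →
      listSum k g ≤ listSum l g
    listSum-⊆ g-cong {[]}    _           k⊆l = 0≤ _
    listSum-⊆ {g} g-cong {s ∷ k} {l} (s∉k ∷ k!) k⊆l =
      let (l′ , eq , keep) = insert g-cong (k⊆l (here (Setoid.refl S)))
      in begin
        g s + listSum k g   ≤⟨ +-mono ≤-refl (listSum-⊆ g-cong k! λ t∈k → keep (k⊆l (there t∈k))
                                 λ s≈t → All.All¬⇒¬Any s∉k (Membership.∈-resp-≈ S (Setoid.sym S s≈t) t∈k)) ⟩
        g s + listSum l′ g  ≈⟨ eq ⟨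
        listSum l g         ∎

    module _ (_≟_ : Decidable _≈ₛ_) where
      decSetoid : DecSetoid 0ℓ 0ℓ
      decSetoid = record
        { isDecEquivalence = record { isEquivalence = Setoid.isEquivalence S ; _≟_ = _≟_ } }

      dedup : List A → List A
      dedup = deduplicate _≟_

      dedup-! : ∀ l → Unique S (dedup l)
      dedup-! = deduplicate-! decSetoid

      ∈-dedup : ∀ {s l} → s ∈ₗ l → s ∈ₗ dedup l
      ∈-dedup = Membership.∈-deduplicate⁺ S _≟_ λ y≈z x≈z → Setoid.trans S x≈z (Setoid.sym S y≈z)

      -- The two sums on the right are approximated on unrelated lists, and both lists fit into
      -- their deduplicated concatenation. The nested use of `∑-least` keeps one sum as an additive
      -- constant while the other becomes finite.
      ∑-+ : ∀ {g h} → g Preserves _≈ₛ_ ⟶ _≈_ → h Preserves _≈ₛ_ ⟶ _≈_ →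
        ∑ S (λ s → g s + h s) ≈ ∑ S g + ∑ S h
      ∑-+ {g} {h} g-cong h-cong = ≤-antisym
        (∑-least₀ λ l l! → ≤-trans (≤-reflexive (listSum-+ l)) (+-mono (∑-upper S g l!) (∑-upper S h l!)))
        (begin
          ∑ S g + ∑ S h       ≈⟨ +-congʳ (*-identityˡ _) ⟨
          1# * ∑ S g + ∑ S h  ≤⟨ ∑-least S g (λ k k! → begin
            1# * listSum k g + ∑ S h   ≈⟨ +-comm _ _ ⟩
            ∑ S h + 1# * listSum k g   ≈⟨ +-cong (sym (*-identityˡ _)) (*-identityˡ _) ⟩
            1# * ∑ S h + listSum k g   ≤⟨ ∑-least S h (λ l l! → merged k k! l l!) ⟩
            ∑ S (λ s → g s + h s)      ∎) ⟩
          ∑ S (λ s → g s + h s)  ∎)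
        where
        merged : ∀ k → Unique S k → ∀ l → Unique S l → 1# * listSum l h + listSum k g ≤ ∑ S (λ s → g s + h s)
        merged k k! l l! = let m = dedup (k ++ l) in begin
          1# * listSum l h + listSum k g   ≈⟨ trans (+-congʳ (*-identityˡ _)) (+-comm _ _) ⟩
          listSum k g + listSum l h        ≤⟨ +-mono
                                                (listSum-⊆ g-cong k! (∈-dedup ∘ Membership.∈-++⁺ˡ S))
                                                (listSum-⊆ h-cong l! (∈-dedup ∘ Membership.∈-++⁺ʳ S k)) ⟩
          listSum m g + listSum m h        ≈⟨ listSum-+ m ⟨
          listSum m (λ s → g s + h s)      ≤⟨ ∑-upper S _ (dedup-! (k ++ l)) ⟩
          ∑ S (λ s → g s + h s)            ∎

  module _ (S T : Setoid 0ℓ 0ℓ) where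
    open Setoid S using () renaming (Carrier to A; _≈_ to _≈ₛ_)
    open Setoid T using () renaming (Carrier to B; _≈_ to _≈ₜ_)

    -- Terms outside `P` vanish, so `σ` has to be injective on `P` only. The exchange of draws is
    -- used in this partial form.
    ∑-inject : ∀ {g h} {P : A → Set} → Unary.Decidable P → (σ : A → B) →
      (∀ {s} → ¬ P s → g s ≤ 0#) → (∀ {s} → P s → g s ≤ h (σ s)) →
      (∀ {s t} → P s → P t → σ s ≈ₜ σ t → s ≈ₛ t) → ∑ S g ≤ ∑ T h
    ∑-inject {g} {h} {P} P? σ g≤0 g≤h inj = ∑-least₀ S λ l l! →
        let (l′ , l′! , _ , le) = image l l! in ≤-trans le (∑-upper T h l′!)
      where
      -- The freshness component keeps the image free of repetitions: an element of `P` new to `l`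
      -- is mapped to an element new to `l′`.
      image : ∀ l → Unique S l →
        ∃[ l′ ] Unique T l′ × (∀ {s} → P s → All (λ t → ¬ s ≈ₛ t) l → All (λ t → ¬ σ s ≈ₜ t) l′)
                × listSum l g ≤ listSum l′ h
      image []      []         = [] , [] , (λ _ _ → []) , ≤-refl
      image (s ∷ l) (s∉l ∷ l!) with P? s | image l l!
      ... | yes Ps | l′ , l′! , fresh , le =
        σ s ∷ l′ , fresh Ps s∉l ∷ l′! ,
        (λ { Pt (t≉s ∷ t∉l) → (t≉s ∘ inj Pt Ps) ∷ fresh Pt t∉l }) , +-mono (g≤h Ps) le
      ... | no ¬Ps | l′ , l′! , fresh , le =
        l′ , l′! , (λ { Pt (_ ∷ t∉l) → fresh Pt t∉l }) , (begin
          g s + listSum l g  ≤⟨ +-mono (g≤0 ¬Ps) le ⟩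
          0# + listSum l′ h  ≈⟨ +-identityˡ _ ⟩
          listSum l′ h       ∎)

  ∑-reindex : ∀ (S T : Setoid 0ℓ 0ℓ) {h} → h Preserves Setoid._≈_ T ⟶ _≈_ →
    (σ : Setoid.Carrier S → Setoid.Carrier T) (τ : Setoid.Carrier T → Setoid.Carrier S) →
    σ Preserves Setoid._≈_ S ⟶ Setoid._≈_ T → (∀ {s t} → Setoid._≈_ T (σ s) (σ t) → Setoid._≈_ S s t) →
    (∀ t → Setoid._≈_ T (σ (τ t)) t) → ∑ T h ≈ ∑ S (h ∘ σ)
  ∑-reindex S T h-cong σ τ σ-cong inj inv = ≤-antisym
    (∑-inject T S {P = λ _ → ⊤} (λ _ → yes tt) τ (contradiction tt)
      (λ {t} _ → ≤-reflexive (h-cong (Setoid.sym T (inv t))))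
      λ {s} {t} _ _ τs≈τt → Setoid.trans T (Setoid.sym T (inv s)) (Setoid.trans T (σ-cong τs≈τt) (inv t)))
    (∑-inject S T {P = λ _ → ⊤} (λ _ → yes tt) σ (contradiction tt) (λ _ → ≤-refl) (λ _ _ → inj))

  module _ (S T : Setoid 0ℓ 0ℓ) (_≟₁_ : Decidable (Setoid._≈_ S)) (_≟₂_ : Decidable (Setoid._≈_ T)) where
    open Setoid S using () renaming (Carrier to A; _≈_ to _≈ₛ_)
    open Setoid T using () renaming (Carrier to B; _≈_ to _≈ₜ_)

    ∑-× : ∀ {g} → g Preserves Setoid._≈_ (S ×ₛ T) ⟶ _≈_ →
      ∑ (S ×ₛ T) g ≈ ∑ S (λ s → ∑ T (λ t → g (s , t)))
    ∑-× {g} g-cong = ≤-antisym (∑-least₀ (S ×ₛ T) upper) (∑-least₀ S λ k k! → begin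
        listSum k G                   ≈⟨ +-identityʳ _ ⟨
        listSum k G + listSum [] g    ≤⟨ lower k k! [] [] [] ⟩
        ∑ (S ×ₛ T) g                  ∎)
      where
      G : A → Carrier
      G s = ∑ T (λ t → g (s , t))

      -- Finitely many pairs lie in a finite rectangle, the product of their deduplicated
      -- projections, which is summed row by row.
      upper : ∀ l → Unique (S ×ₛ T) l → listSum l g ≤ ∑ S G
      upper l l! = let k₁ = dedup S _≟₁_ (map proj₁ l) ; k₂ = dedup T _≟₂_ (map proj₂ l) in begin
        listSum l g                                      ≤⟨ listSum-⊆ (S ×ₛ T) g-cong l! (λ p∈l →
          Membership.∈-cartesianProduct⁺ S T
            (∈-dedup S _≟₁_ (Membership.∈-map⁺ (S ×ₛ T) S proj₁ p∈l))
            (∈-dedup T _≟₂_ (Membership.∈-map⁺ (S ×ₛ T) T proj₂ p∈l))) ⟩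
        listSum (cartesianProduct k₁ k₂) g               ≈⟨ listSum-cartesian k₁ k₂ ⟩
        listSum k₁ (λ s → listSum k₂ (λ t → g (s , t)))  ≤⟨ listSum-mono k₁ (λ s →
                                                              ∑-upper T _ (dedup-! T _≟₂_ (map proj₂ l))) ⟩
        listSum k₁ G                                     ≤⟨ ∑-upper S _ (dedup-! S _≟₁_ (map proj₁ l)) ⟩
        ∑ S G                                            ∎

      -- Generalised for the induction: `k` lists the rows whose inner sums are still infinite, `l`
      -- the pairs already selected in other rows. Each step replaces one infinite row by a finite
      -- list, with everything else as the additive constant of `∑-least`.
      lower : ∀ k → Unique S k → ∀ l → Unique (S ×ₛ T) l → All (λ p → All (λ s → ¬ s ≈ₛ proj₁ p) k) l →
        listSum k G + listSum l g ≤ ∑ (S ×ₛ T) g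
      lower []      k!         l l! _   = begin
        0# + listSum l g   ≈⟨ +-identityˡ _ ⟩
        listSum l g        ≤⟨ ∑-upper (S ×ₛ T) g l! ⟩
        ∑ (S ×ₛ T) g       ∎
      lower (s ∷ k) (s∉k ∷ k!) l l! k#l = begin
        (G s + listSum k G) + listSum l g       ≈⟨ +-assoc _ _ _ ⟩
        G s + (listSum k G + listSum l g)       ≈⟨ +-congʳ (*-identityˡ _) ⟨
        1# * G s + (listSum k G + listSum l g)  ≤⟨ ∑-least T _ (λ m m! → let m′ = map (s ,_) m in begin
          1# * listSum m (λ t → g (s , t)) + (listSum k G + listSum l g)
            ≈⟨ +-congʳ (trans (*-identityˡ _) (sym (listSum-map (s ,_) m))) ⟩
          listSum m′ g + (listSum k G + listSum l g)   ≈⟨ x+yz≈y+xz _ _ _ ⟩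
          listSum k G + (listSum m′ g + listSum l g)   ≈⟨ +-congˡ (listSum-++ m′ l) ⟨
          listSum k G + listSum (m′ ++ l) g            ≤⟨ lower k k! (m′ ++ l)
            (AllPairs.++⁺ (Unique.map⁺ T (S ×ₛ T) proj₂ m!) l!
              (All.map⁺ (All.universal (λ t → All.map (λ { (s≉ ∷ _) (s≈ , _) → s≉ s≈ }) k#l) m)))
            (All.++⁺ (All.map⁺ (All.universal (λ t → All.map (λ s≉ s≈ → s≉ (Setoid.sym S s≈)) s∉k) m))
                     (All.map (λ { (_ ∷ p) → p }) k#l)) ⟩
          ∑ (S ×ₛ T) g                                 ∎) ⟩
        ∑ (S ×ₛ T) g                            ∎

  ∑-swap : ∀ {S T : Setoid 0ℓ 0ℓ} (let open Setoid S using () renaming (Carrier to A; _≈_ to _≈ₛ_))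
    (let open Setoid T using () renaming (Carrier to B; _≈_ to _≈ₜ_)) →
    Decidable _≈ₛ_ → Decidable _≈ₜ_ →
    {g : A → B → Carrier} → (∀ {s s′ t t′} → s ≈ₛ s′ → t ≈ₜ t′ → g s t ≈ g s′ t′) →
    ∑ S (λ s → ∑ T (λ t → g s t)) ≈ ∑ T (λ t → ∑ S (λ s → g s t))
  ∑-swap {S} {T} _≟₁_ _≟₂_ g-cong = trans (sym (∑-× S T _≟₁_ _≟₂_ λ (p , q) → g-cong p q)) (trans
    (∑-reindex (T ×ₛ S) (S ×ₛ T) (λ (p , q) → g-cong p q) swap swap swap swap
      (λ _ → Setoid.refl S , Setoid.refl T))
    (∑-× T S _≟₂_ _≟₁_ λ (p , q) → g-cong q p))

  ⟦_⟧ : Bool → Carrier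
  ⟦ b ⟧ = if b then 1# else 0#

  ∑-dirac : ∀ {A : Set} (_≟_ : DecidableEquality A) (x : A) (g : A → Carrier) →
    ∑ (setoid A) (λ t → ⟦ does (x ≟ t) ⟧ * g t) ≈ g x
  ∑-dirac {A} _≟_ x g = ≤-antisym (∑-least₀ (setoid A) bound) (begin
      g x                       ≈⟨ *-identityˡ _ ⟨
      1# * g x                  ≤⟨ at-x ⟩
      ⟦ does (x ≟ x) ⟧ * g x    ≤⟨ ∑-term (setoid A) _ x ⟩
      ∑ (setoid A) _            ∎)
    where
    at-x : 1# * g x ≤ ⟦ does (x ≟ x) ⟧ * g x
    at-x with x ≟ x
    ... | yes _  = ≤-refl
    ... | no x≢x = contradiction ≡.refl x≢x
    none : ∀ l → All (λ t → ¬ x ≡ t) l → listSum l (λ t → ⟦ does (x ≟ t) ⟧ * g t) ≤ 0#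
    none []      _           = ≤-refl
    none (t ∷ l) (x≢t ∷ x∉l) with x ≟ t
    ... | yes x≡t = contradiction x≡t x≢t
    ... | no  _   = ≤-trans (+-mono (≤-reflexive (zeroˡ _)) (none l x∉l)) (≤-reflexive (+-identityˡ 0#))
    bound : ∀ l → Unique (setoid A) l → listSum l (λ t → ⟦ does (x ≟ t) ⟧ * g t) ≤ g x
    bound []      _          = 0≤ _
    bound (t ∷ l) (t∉l ∷ l!) with x ≟ t
    ... | yes ≡.refl = ≤-trans (+-mono (≤-reflexive (*-identityˡ _)) (none l t∉l)) (≤-reflexive (+-identityʳ _))
    ... | no  _      = ≤-trans (+-mono (≤-reflexive (zeroˡ _)) (bound l l!)) (≤-reflexive (+-identityˡ _))

splice : ∀ {n} {D : Fin n → Set} → Subset n → (∀ i → D i) → (∀ i → D i) → ∀ i → D i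
splice S w x i = if does (i ∈? S) then w i else x i

-- Product distributions

module ProductDistribution (R : ∑-Semiring) where
  open ∑-Semiring R
  open Summation R
  open PartialOrderReasoning ≤-poset

  record Family (n : ℕ) : Set₁ where
    field
      D     : Fin n → Set
      _≟_   : ∀ {i} → DecidableEquality (D i)
      μ     : ∀ i → D i → Carrier
      total : ∀ i → ∑ (setoid (D i)) (μ i) ≈ 1#

    Assignment : Set
    Assignment = ∀ i → D i

    assignments : Setoid 0ℓ 0ℓ
    assignments = Πₛ D

    open Setoid assignments public using () renaming (_≈_ to _≐_)

    _≐?_ : Decidable _≐_
    x ≐? y = Fin.all? λ i → x i ≟ y i

    𝒟 : Assignment → Carrier
    𝒟 w = Vector.foldr _*_ 1# λ i → μ i (w i)

    E : (Assignment → Carrier) → Carrier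
    E f = ∑ assignments λ w → 𝒟 w * f w

  tail : ∀ {n} → Family (suc n) → Family n
  tail F = record { D = D ∘ suc ; _≟_ = _≟_ ; μ = μ ∘ suc ; total = total ∘ suc }
    where open Family F

  open Family using (assignments; 𝒟; E)

  cons : ∀ {n} (D : Fin (suc n) → Set) → D zero → (∀ i → D (suc i)) → ∀ i → D i
  cons D d w zero    = d
  cons D d w (suc i) = w i

  cons-cong : ∀ {n} (D : Fin (suc n) → Set) (d : D zero) {v w : ∀ i → D (suc i)} →
    (∀ i → v i ≡ w i) → ∀ i → cons D d v i ≡ cons D d w i
  cons-cong D d v≐w zero    = ≡.refl
  cons-cong D d v≐w (suc i) = v≐w i

  ∑-uncons : ∀ {n} (F : Family (suc n)) (let open Family F using (D)) {g : (∀ i → D i) → Carrier} →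
    g Preserves Family._≐_ F ⟶ _≈_ →
    ∑ (assignments F) g ≈ ∑ (setoid (D zero)) (λ d → ∑ (assignments (tail F)) (λ w → g (cons D d w)))
  ∑-uncons F {g} g-cong = trans
    (∑-reindex (setoid (D zero) ×ₛ assignments (tail F)) (assignments F) g-cong
      (λ (d , w) → cons D d w) (λ x → x zero , x ∘ suc)
      (λ { (≡.refl , v≐w) → cons-cong D _ v≐w })
      (λ eq → eq zero , eq ∘ suc)
      (λ { x zero → ≡.refl ; x (suc i) → ≡.refl }))
    (∑-× _ _ _≟_ (Family._≐?_ (tail F)) (λ { (≡.refl , v≐w) → g-cong (cons-cong D _ v≐w) }))
    where open Family F using (D; _≟_)

  ∏-cong : ∀ {n} {f g : Fin n → Carrier} → (∀ i → f i ≈ g i) → Vector.foldr _*_ 1# f ≈ Vector.foldr _*_ 1# g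
  ∏-cong = Sum.sum-cong-≋ *-commutativeMonoid

  μ-cong : ∀ {n} (F : Family n) (let open Family F) i {d e} → d ≡ e → μ i d ≈ μ i e
  μ-cong F i ≡.refl = refl

  𝒟-cong : ∀ {n} (F : Family n) → 𝒟 F Preserves Family._≐_ F ⟶ _≈_
  𝒟-cong F x≐y = ∏-cong λ i → μ-cong F i (x≐y i)

  𝒟-total : ∀ {n} (F : Family n) → ∑ (assignments F) (𝒟 F) ≈ 1#
  𝒟-total {zero}  F = ∑-singleton (assignments F) (λ _ → refl) (λ ()) (λ _ ())
  𝒟-total {suc n} F = begin-equality
    ∑ (assignments F) (𝒟 F)                      ≈⟨ ∑-uncons F (𝒟-cong F) ⟩
    ∑ (setoid (D zero)) (λ d → ∑ (assignments (tail F)) (λ w → μ zero d * 𝒟 (tail F) w))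
      ≈⟨ ∑-cong _ (λ d → trans (sym (∑-*ˡ _ _ (μ zero d))) (trans (*-congˡ (𝒟-total (tail F))) (*-identityʳ _))) ⟩
    ∑ (setoid (D zero)) (μ zero)                 ≈⟨ total zero ⟩
    1#                                           ∎
    where open Family F using (D; μ; total)

  module _ {n} (F : Family n) where
    open Family F hiding (assignments; 𝒟; E)

    E-mono : ∀ {f g} → (∀ x → f x ≤ g x) → E F f ≤ E F g
    E-mono f≤g = ∑-mono _ λ x → *-mono ≤-refl (f≤g x)

    E-cong : ∀ {f g} → (∀ x → f x ≈ g x) → E F f ≈ E F g
    E-cong f≈g = ∑-cong _ λ x → *-congˡ (f≈g x)

    E-*ʳ : ∀ f c → E F (λ x → f x * c) ≈ E F f * c
    E-*ʳ f c = trans (∑-cong _ λ x → sym (*-assoc _ _ c)) (sym (∑-*ʳ _ _ c))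

    E-const : ∀ c → E F (λ _ → c) ≈ c
    E-const c = trans (sym (∑-*ʳ _ (𝒟 F) c)) (trans (*-congʳ (𝒟-total F)) (*-identityˡ c))

    E-+ : ∀ {f g} → f Preserves _≐_ ⟶ _≈_ → g Preserves _≐_ ⟶ _≈_ →
      E F (λ x → f x + g x) ≈ E F f + E F g
    E-+ f-cong g-cong = trans (∑-cong _ λ x → distribˡ _ _ _)
      (∑-+ _ _≐?_ (λ p → *-cong (𝒟-cong F p) (f-cong p)) (λ p → *-cong (𝒟-cong F p) (g-cong p)))

    E-term : ∀ f z → 𝒟 F z * f z ≤ E F f
    E-term f z = ∑-term (assignments F) _ z

  resample-splice : ∀ {n} (F : Family n) (let open Family F hiding (assignments; 𝒟; E))
    (b : Fin n → Bool) (x : Assignment) {g : Assignment → Carrier} →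
    g Preserves _≐_ ⟶ _≈_ →
    ∑ (assignments F) (λ y → Vector.foldr _*_ 1# (λ i → if b i then μ i (y i) else ⟦ does (x i ≟ y i) ⟧) * g y) ≈
    E F (λ w → g (λ i → if b i then w i else x i))
  resample-splice {zero}  F b x g-cong = ∑-cong _ λ y → *-congˡ (g-cong λ ())
  resample-splice {suc n} F b x {g} g-cong = begin-equality
    ∑ (assignments F) (λ y → Vector.foldr _*_ 1# (λ i → h i (y i)) * g y)
      ≈⟨ ∑-uncons F (λ p → *-cong (∏-cong λ i → reflexive (≡.cong (h i) (p i))) (g-cong p)) ⟩
    ∑ (setoid (D zero)) (λ d → ∑ (assignments F′) (λ w →
        (h zero d * Vector.foldr _*_ 1# (λ i → h (suc i) (w i))) * g (cons D d w)))
      ≈⟨ ∑-cong _ (λ d → trans (trans (∑-cong _ λ w → *-assoc _ _ _) (sym (∑-*ˡ _ _ _)))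
           (*-congˡ (resample-splice F′ (b ∘ suc) (x ∘ suc) (g-cong ∘ cons-cong D d)))) ⟩
    ∑ (setoid (D zero)) (λ d → h zero d * H d)
      ≈⟨ head ⟩
    ∑ (setoid (D zero)) (λ d → μ zero d * H (if b zero then d else x zero))
      ≈⟨ ∑-cong _ (λ d → trans (*-congˡ (E-cong F′ λ w → g-cong λ { zero → ≡.refl ; (suc i) → ≡.refl }))
           (trans (∑-*ˡ _ _ _) (∑-cong _ λ w → sym (*-assoc _ _ _)))) ⟩
    ∑ (setoid (D zero)) (λ d → ∑ (assignments F′) (λ w →
        (μ zero d * 𝒟 F′ w) * g (λ i → if b i then cons D d w i else x i)))
      ≈⟨ ∑-uncons F (λ p → *-cong (𝒟-cong F p) (g-cong λ i → ≡.cong (λ d → if b i then d else x i) (p i))) ⟨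
    E F (λ w → g (λ i → if b i then w i else x i)) ∎
    where
    open Family F hiding (assignments; 𝒟; E)
    F′ = tail F
    h : ∀ i → D i → Carrier
    h i d = if b i then μ i d else ⟦ does (x i ≟ d) ⟧
    H : D zero → Carrier
    H d = E F′ λ w → g (cons D d (λ i → if b (suc i) then w i else x (suc i)))
    head : ∑ (setoid (D zero)) (λ d → h zero d * H d) ≈
           ∑ (setoid (D zero)) (λ d → μ zero d * H (if b zero then d else x zero))
    -- If the coordinate `zero` is kept, the Dirac factor evaluates `H` at `x zero`; on the other
    -- side the draw of `d` contributes its total mass 1.
    head with b zero
    ... | true  = refl
    ... | false = trans (∑-dirac _≟_ (x zero) H)
      (trans (sym (*-identityˡ _)) (trans (*-congʳ (sym (total zero))) (∑-*ʳ _ (μ zero) _)))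

-- The resampling process

module Dynamics {n} (D : Fin n → Set) (scope : (∀ i → D i) → Subset n)
  (scope-cong : ∀ {x y} → (∀ i → x i ≡ y i) → scope x ≡ scope y) where

  open Setoid (Πₛ D) using () renaming (Carrier to Assignment; _≈_ to _≐_)

  next : Assignment → Assignment → Assignment
  next x w = splice (scope x) w x

  splice-cong : ∀ {S T} → S ≡ T → ∀ {v w x y} → v ≐ w → x ≐ y → splice S v x ≐ splice T w y
  splice-cong {S} ≡.refl v≐w x≐y i with does (i ∈? S)
  ... | true  = v≐w i
  ... | false = x≐y i

  next-cong : ∀ {x y} → x ≐ y → ∀ {v w} → v ≐ w → next x v ≐ next y w
  next-cong x≐y v≐w = splice-cong (scope-cong x≐y) v≐w x≐y

  orbit : Assignment → ℕ → Assignment → Assignment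
  orbit z zero    x = x
  orbit z (suc t) x = orbit z t (next x z)

  -- The samples used by t iterations of the loop, and one further, unused sample.
  Draws : ℕ → Setoid 0ℓ 0ℓ
  Draws zero    = Πₛ D
  Draws (suc t) = Πₛ D ×ₛ Draws t

  final : ∀ t → Assignment → Setoid.Carrier (Draws t) → Assignment
  final zero    x z       = x
  final (suc t) x (w , r) = final t (next x w) r

  unused : ∀ t → Setoid.Carrier (Draws t) → Assignment
  unused zero    z       = z
  unused (suc t) (w , r) = unused t r

  -- Exchanges, for each index i, the value of i in the final state (the last one drawn for i)
  -- with the unused sample of i.
  exchange : ∀ t → Setoid.Carrier (Draws (suc t)) → Setoid.Carrier (Draws (suc t))
  exchange zero    (x , z)     = z , x
  exchange (suc t) (x , w , r) =
    let (y , r′) = exchange t (next x w , r)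
    in splice (scope x) x y , splice (scope x) y w , r′

  exchange-cong : ∀ t {s s′} → Setoid._≈_ (Draws (suc t)) s s′ →
    Setoid._≈_ (Draws (suc t)) (exchange t s) (exchange t s′)
  exchange-cong zero    (x≐x′ , z≐z′) = z≐z′ , x≐x′
  exchange-cong (suc t) (x≐x′ , w≐w′ , r≈r′) =
    let (y≐y′ , eq) = exchange-cong t (next-cong x≐x′ w≐w′ , r≈r′)
    in splice-cong (scope-cong x≐x′) x≐x′ y≐y′ , splice-cong (scope-cong x≐x′) y≐y′ w≐w′ , eq

  final-cong : ∀ t {x x′ r r′} → x ≐ x′ → Setoid._≈_ (Draws t) r r′ → final t x r ≐ final t x′ r′
  final-cong zero    x≐x′ _              = x≐x′
  final-cong (suc t) x≐x′ (w≐w′ , r≈r′) = final-cong t (next-cong x≐x′ w≐w′) r≈r′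

  unused-cong : ∀ t {r r′} → Setoid._≈_ (Draws t) r r′ → unused t r ≐ unused t r′
  unused-cong zero    z≐z′         = z≐z′
  unused-cong (suc t) (_ , r≈r′) = unused-cong t r≈r′

  unused-exchange : ∀ t x r → unused t (proj₂ (exchange t (x , r))) ≡ final t x r
  unused-exchange zero    x z       = ≡.refl
  unused-exchange (suc t) x (w , r) = unused-exchange t (next x w) r

  -- The interface between combinatorics and probability: the two axioms enter the probabilistic
  -- argument only through this property.
  Reversible : (Assignment → Bool) → Set
  Reversible Φ = ∀ t x r → Φ (final t x r) ≡ true → Φ (unused t r) ≡ true →
    let (x′ , r′) = exchange t (x , r) in
    Setoid._≈_ (Draws (suc t)) (exchange t (x′ , r′)) (x , r) × final t x′ r′ ≐ unused t r

module Resampling (R : ∑-Semiring) {n} (F : ProductDistribution.Family R n)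
  (scope : ProductDistribution.Family.Assignment F → Subset n)
  (scope-cong : ∀ {x y} → ProductDistribution.Family._≐_ F x y → scope x ≡ scope y) where
  open ∑-Semiring R
  open Summation R
  open ProductDistribution R
  open Family F
  open PartialOrderReasoning ≤-poset
  open CommutativeSemigroupProperties *-commutativeSemigroup using ()
    renaming (x∙yz≈y∙xz to x*yz≈y*xz)
  open Dynamics D scope scope-cong

  expect : ℕ → (Assignment → Carrier) → Assignment → Carrier
  expect zero    g = g
  expect (suc t) g = λ x → E λ w → expect t g (next x w)

  expect-cong : ∀ t {g} → g Preserves _≐_ ⟶ _≈_ → expect t g Preserves _≐_ ⟶ _≈_
  expect-cong zero    g-cong x≐y = g-cong x≐y
  expect-cong (suc t) g-cong x≐y = E-cong F λ w → expect-cong t g-cong (next-cong x≐y λ _ → ≡.refl)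

  expect-mono : ∀ t {f g} → (∀ x → f x ≤ g x) → ∀ x → expect t f x ≤ expect t g x
  expect-mono zero    f≤g x = f≤g x
  expect-mono (suc t) f≤g x = E-mono F λ w → expect-mono t f≤g (next x w)

  expect-+ : ∀ t k g x → expect (t ℕ.+ k) g x ≈ expect t (expect k g) x
  expect-+ zero    k g x = refl
  expect-+ (suc t) k g x = E-cong F λ w → expect-+ t k g (next x w)

  -- `expect` unfolds at the first iteration and `law` at the last one; this mediates between the
  -- two recursions.
  expect-suc : ∀ t g x → expect (suc t) g x ≈ expect t (expect 1 g) x
  expect-suc zero    g x = refl
  expect-suc (suc t) g x = E-cong F λ w → expect-suc t g (next x w)

  expect-const : ∀ t c x → expect t (λ _ → c) x ≈ c
  expect-const zero    c x = refl
  expect-const (suc t) c x = trans (E-cong F λ w → expect-const t c (next x w)) (E-const F c)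

  expect-*ʳ : ∀ t g c x → expect t (λ y → g y * c) x ≈ expect t g x * c
  expect-*ʳ zero    g c x = refl
  expect-*ʳ (suc t) g c x = trans (E-cong F λ w → expect-*ʳ t g c (next x w)) (E-*ʳ F _ c)

  expect-distrib-+ : ∀ t {f g} → f Preserves _≐_ ⟶ _≈_ → g Preserves _≐_ ⟶ _≈_ →
    ∀ x → expect t (λ y → f y + g y) x ≈ expect t f x + expect t g x
  expect-distrib-+ zero    f-cong g-cong x = refl
  expect-distrib-+ (suc t) f-cong g-cong x = trans (E-cong F λ w → expect-distrib-+ t f-cong g-cong (next x w))
    (E-+ F (λ p → expect-cong t f-cong (next-cong (λ _ → ≡.refl) p))
         (λ p → expect-cong t g-cong (next-cong (λ _ → ≡.refl) p)))

  power : Carrier → ℕ → Carrier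
  power c zero    = 1#
  power c (suc t) = c * power c t

  -- Each expectation is bounded below by its single term at `z`. Together these terms form the
  -- event that all `t` samples equal `z`.
  expect-orbit : ∀ z t g x → power (𝒟 z) t * g (orbit z t x) ≤ expect t g x
  expect-orbit z zero    g x = ≤-reflexive (*-identityˡ _)
  expect-orbit z (suc t) g x = begin
    (𝒟 z * power (𝒟 z) t) * g (orbit z t (next x z))   ≈⟨ *-assoc _ _ _ ⟩
    𝒟 z * (power (𝒟 z) t * g (orbit z t (next x z)))   ≤⟨ *-mono ≤-refl (expect-orbit z t g (next x z)) ⟩
    𝒟 z * expect t g (next x z)                             ≤⟨ E-term F (λ w → expect t g (next x w)) z ⟩
    expect (suc t) g x                                      ∎

  ⟦⟧-cong : ∀ {A : Assignment → Bool} → A Preserves _≐_ ⟶ _≡_ → (λ x → ⟦ A x ⟧) Preserves _≐_ ⟶ _≈_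
  ⟦⟧-cong A-cong x≐y = reflexive (≡.cong ⟦_⟧ (A-cong x≐y))

  resample : Subset n → Assignment → Assignment → Carrier
  resample S x y = Vector.foldr _*_ 1# λ i → if does (i ∈? S) then μ i (y i) else ⟦ does (x i ≟ y i) ⟧

  resample-cong : ∀ {S T x x′ y y′} → S ≡ T → x ≐ x′ → y ≐ y′ → resample S x y ≈ resample T x′ y′
  resample-cong {S} ≡.refl x≐x′ y≐y′ = ∏-cong λ i → reflexive (≡.cong₂
    (λ d e → if does (i ∈? S) then μ i e else ⟦ does (d ≟ e) ⟧) (x≐x′ i) (y≐y′ i))

  -- Staying in place is a resampling of the empty scope, so both branches of `step` are covered by
  -- one kernel.
  resample-⊥ : ∀ x y → Vector.foldr _*_ 1# (λ i → ⟦ does (x i ≟ y i) ⟧) ≈ resample ⊥ x y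
  resample-⊥ x y = ∏-cong λ i → reflexive (≡.cong (λ c → if c then μ i (y i) else ⟦ does (x i ≟ y i) ⟧)
    (≡.sym (dec-false (i ∈? ⊥) ∉⊥)))

  Pr-after : ℕ → (Assignment → Bool) → Carrier
  Pr-after t A = E (expect t λ x → ⟦ A x ⟧)

  module Law (step : Assignment → Assignment → Carrier) (law : ℕ → Assignment → Carrier)
    (step-resample : ∀ x y → step x y ≈ resample (scope x) x y)
    (law-zero : ∀ y → law zero y ≈ 𝒟 y)
    (law-suc : ∀ t y → law (suc t) y ≈ ∑ assignments (λ x → law t x * step x y)) where

    step-cong : ∀ {x x′ y y′} → x ≐ x′ → y ≐ y′ → step x y ≈ step x′ y′
    step-cong x≐x′ y≐y′ = trans (step-resample _ _)
      (trans (resample-cong (scope-cong x≐x′) x≐x′ y≐y′) (sym (step-resample _ _)))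

    step-next : ∀ x {g} → g Preserves _≐_ ⟶ _≈_ → ∑ assignments (λ y → step x y * g y) ≈ E (λ w → g (next x w))
    step-next x g-cong = trans (∑-cong assignments λ y → *-congʳ (step-resample x y))
      (resample-splice F (λ i → does (i ∈? scope x)) x g-cong)

    law-cong : ∀ t → law t Preserves _≐_ ⟶ _≈_
    law-cong zero    x≐y = trans (law-zero _) (trans (𝒟-cong F x≐y) (sym (law-zero _)))
    law-cong (suc t) x≐y = trans (law-suc t _)
      (trans (∑-cong assignments λ x → *-congˡ (step-cong (λ _ → ≡.refl) x≐y)) (sym (law-suc t _)))

    -- Swapping the two sums moves the last transition from the law to the test function, which is
    -- why the induction on `t` ranges over all `g`.
    law-expectation : ∀ t {g} → g Preserves _≐_ ⟶ _≈_ → ∑ assignments (λ y → law t y * g y) ≈ E (expect t g)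
    law-expectation zero    g-cong = ∑-cong assignments λ y → *-congʳ (law-zero y)
    law-expectation (suc t) {g} g-cong = begin-equality
      ∑ assignments (λ y → law (suc t) y * g y)
        ≈⟨ ∑-cong _ (λ y → trans (*-congʳ (law-suc t y)) (∑-*ʳ _ _ (g y))) ⟩
      ∑ assignments (λ y → ∑ assignments (λ x → (law t x * step x y) * g y))
        ≈⟨ ∑-swap _≐?_ _≐?_ (λ p q → *-cong (*-cong (law-cong t q) (step-cong q p)) (g-cong p)) ⟩
      ∑ assignments (λ x → ∑ assignments (λ y → (law t x * step x y) * g y))
        ≈⟨ ∑-cong _ (λ x → trans (∑-cong _ λ y → *-assoc _ _ _)
             (trans (sym (∑-*ˡ _ _ _)) (*-congˡ (step-next x g-cong)))) ⟩
      ∑ assignments (λ x → law t x * expect 1 g x)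
        ≈⟨ law-expectation t (expect-cong 1 g-cong) ⟩
      E (expect t (expect 1 g))
        ≈⟨ E-cong F (λ x → sym (expect-suc t g x)) ⟩
      E (expect (suc t) g) ∎

    law-Bool : ∀ t {A} → A Preserves _≐_ ⟶ _≡_ →
      ∑ assignments (λ y → law t y * ⟦ A y ⟧) ≈ Pr-after t A
    law-Bool t A-cong = law-expectation t (⟦⟧-cong A-cong)

  ≈? : ∀ t → Decidable (Setoid._≈_ (Draws t))
  ≈? zero    x y             = x ≐? y
  ≈? (suc t) (x , r) (y , s) = (x ≐? y) ×-dec ≈? t r s

  weight : ∀ t → Setoid.Carrier (Draws t) → Carrier
  weight zero    z       = 𝒟 z
  weight (suc t) (w , r) = 𝒟 w * weight t r

  weight-cong : ∀ t → weight t Preserves Setoid._≈_ (Draws t) ⟶ _≈_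
  weight-cong zero    p       = 𝒟-cong F p
  weight-cong (suc t) (p , q) = *-cong (𝒟-cong F p) (weight-cong t q)

  𝒟-*-𝒟 : ∀ {w x y z} → (∀ i → μ i (w i) * μ i (x i) ≈ μ i (y i) * μ i (z i)) → 𝒟 w * 𝒟 x ≈ 𝒟 y * 𝒟 z
  𝒟-*-𝒟 {w} {x} {y} {z} eq = trans (sym (∏-* (λ i → μ i (w i)) λ i → μ i (x i)))
    (trans (∏-cong eq) (∏-* (λ i → μ i (y i)) λ i → μ i (z i)))
    where ∏-* = Sum.∑-distrib-+ *-commutativeMonoid {n}

  -- The exchange only permutes the values drawn for each index. `splice S x w` collects the values
  -- that this iteration leaves out of the exchange, namely those overwritten on `S` and those drawn
  -- in vain off `S`; the others form `next x w`, on which the induction acts.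
  weight-exchange : ∀ t s → weight (suc t) (exchange t s) ≈ weight (suc t) s
  weight-exchange zero    (x , z)     = *-comm _ _
  weight-exchange (suc t) (x , w , r) = let S = scope x ; (y , r′) = exchange t (next x w , r) in begin-equality
    𝒟 (splice S x y) * (𝒟 (splice S y w) * weight t r′)       ≈⟨ *-assoc _ _ _ ⟨
    (𝒟 (splice S x y) * 𝒟 (splice S y w)) * weight t r′       ≈⟨ *-congʳ (𝒟-*-𝒟 (outer S y)) ⟩
    (𝒟 (splice S x w) * 𝒟 y) * weight t r′                    ≈⟨ *-assoc _ _ _ ⟩
    𝒟 (splice S x w) * (𝒟 y * weight t r′)                    ≈⟨ *-congˡ (weight-exchange t (next x w , r)) ⟩
    𝒟 (splice S x w) * (𝒟 (next x w) * weight t r)            ≈⟨ *-assoc _ _ _ ⟨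
    (𝒟 (splice S x w) * 𝒟 (next x w)) * weight t r            ≈⟨ *-congʳ (𝒟-*-𝒟 (inner S)) ⟩
    (𝒟 x * 𝒟 w) * weight t r                                  ≈⟨ *-assoc _ _ _ ⟩
    𝒟 x * (𝒟 w * weight t r)                                  ∎
    where
    outer : ∀ S y i → μ i (splice S x y i) * μ i (splice S y w i) ≈ μ i (splice S x w i) * μ i (y i)
    outer S y i with does (i ∈? S)
    ... | true  = refl
    ... | false = *-comm _ _
    inner : ∀ S i → μ i (splice S x w i) * μ i (splice S w x i) ≈ μ i (x i) * μ i (w i)
    inner S i with does (i ∈? S)
    ... | true  = refl
    ... | false = *-comm _ _

  expectation-draws : ∀ t {b c : Assignment → Carrier} → b Preserves _≐_ ⟶ _≈_ → c Preserves _≐_ ⟶ _≈_ → ∀ x →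
    ∑ (Draws t) (λ r → weight t r * (b (final t x r) * c (unused t r))) ≈ expect t b x * E c
  expectation-draws zero    {b} {c} b-cong c-cong x =
    trans (∑-cong _ λ z → x*yz≈y*xz _ _ _) (sym (∑-*ˡ _ _ (b x)))
  expectation-draws (suc t) {b} {c} b-cong c-cong x = begin-equality
    ∑ (Draws (suc t)) (λ (w , r) → (𝒟 w * weight t r) * (b (final t (next x w) r) * c (unused t r)))
      ≈⟨ ∑-× _ _ _≐?_ (≈? t) (λ (p , q) → *-cong (*-cong (𝒟-cong F p) (weight-cong t q))
           (*-cong (b-cong (final-cong t (next-cong (λ _ → ≡.refl) p) q)) (c-cong (unused-cong t q)))) ⟩
    ∑ assignments (λ w → ∑ (Draws t) (λ r → (𝒟 w * weight t r) * (b (final t (next x w) r) * c (unused t r))))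
      ≈⟨ ∑-cong _ (λ w → trans (∑-cong _ λ r → *-assoc _ _ _) (trans (sym (∑-*ˡ _ _ _))
           (*-congˡ (expectation-draws t b-cong c-cong (next x w))))) ⟩
    E (λ w → expect t b (next x w) * E c)
      ≈⟨ E-*ʳ F _ _ ⟩
    expect (suc t) b x * E c ∎

  module _ (Φ : Assignment → Bool) (Φ-cong : Φ Preserves _≐_ ⟶ _≡_) where

    module _ (reverse : Reversible Φ) where

      module _ {b c : Assignment → Carrier} (b-cong : b Preserves _≐_ ⟶ _≈_) (c-cong : c Preserves _≐_ ⟶ _≈_)
        (b-Φ : ∀ x → Φ x ≡ false → b x ≈ 0#) (c-Φ : ∀ x → Φ x ≡ false → c x ≈ 0#) where

        -- Since `b` and `c` vanish where Φ fails, only good draws contribute. On these the exchange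
        -- preserves weight, swaps the arguments of `b` and `c`, and is injective because a second
        -- exchange undoes it.
        exchange-≤ : ∀ t → E (expect t b) * E c ≤ E (expect t c) * E b
        exchange-≤ t = begin
          E (expect t b) * E c                   ≈⟨ expand b-cong c-cong ⟨
          ∑ (Draws (suc t)) (H b c)         ≤⟨ ∑-inject (Draws (suc t)) (Draws (suc t)) {P = Good}
                                                 good? (exchange t) bad good injective ⟩
          ∑ (Draws (suc t)) (H c b)         ≈⟨ expand c-cong b-cong ⟩
          E (expect t c) * E b                   ∎
          where
          H : (Assignment → Carrier) → (Assignment → Carrier) → Setoid.Carrier (Draws (suc t)) → Carrier
          H f g (x , r) = weight (suc t) (x , r) * (f (final t x r) * g (unused t r))

          expand : ∀ {f g} → f Preserves _≐_ ⟶ _≈_ → g Preserves _≐_ ⟶ _≈_ →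
            ∑ (Draws (suc t)) (H f g) ≈ E (expect t f) * E g
          expand {f} {g} f-cong g-cong = begin-equality
            ∑ (Draws (suc t)) (H f g)
              ≈⟨ ∑-× _ _ _≐?_ (≈? t) (λ (p , q) → *-cong (*-cong (𝒟-cong F p) (weight-cong t q))
                   (*-cong (f-cong (final-cong t p q)) (g-cong (unused-cong t q)))) ⟩
            ∑ assignments (λ x → ∑ (Draws t) (λ r → H f g (x , r)))
              ≈⟨ ∑-cong _ (λ x → trans (∑-cong _ λ r → *-assoc _ _ _) (trans (sym (∑-*ˡ _ _ _))
                   (*-congˡ (expectation-draws t f-cong g-cong x)))) ⟩
            E (λ x → expect t f x * E g)
              ≈⟨ E-*ʳ F _ _ ⟩
            E (expect t f) * E g ∎

          Good : Setoid.Carrier (Draws (suc t)) → Set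
          Good (x , r) = Φ (final t x r) ≡ true × Φ (unused t r) ≡ true

          good? : ∀ s → Dec (Good s)
          good? (x , r) = (Φ (final t x r) Bool.≟ true) ×-dec (Φ (unused t r) Bool.≟ true)

          bad : ∀ {s} → ¬ Good s → H b c s ≤ 0#
          bad {x , r} ¬good with Φ (final t x r) in final-Φ | Φ (unused t r) in unused-Φ
          ... | true  | true  = contradiction (≡.refl , ≡.refl) ¬good
          ... | false | _     = ≤-reflexive
            (trans (*-congˡ (trans (*-congʳ (b-Φ _ final-Φ)) (zeroˡ _))) (zeroʳ _))
          ... | true  | false = ≤-reflexive
            (trans (*-congˡ (trans (*-congˡ (c-Φ _ unused-Φ)) (zeroʳ _))) (zeroʳ _))

          good : ∀ {s} → Good s → H b c s ≤ H c b (exchange t s)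
          good {x , r} (final-Φ , unused-Φ) =
            let (_ , final≐) = reverse t x r final-Φ unused-Φ in ≤-reflexive (*-cong
              (sym (weight-exchange t (x , r)))
              (trans (*-comm _ _) (*-cong (c-cong λ i → ≡.sym (final≐ i))
                (reflexive (≡.cong b (≡.sym (unused-exchange t x r)))))))

          injective : ∀ {s s′} → Good s → Good s′ → Setoid._≈_ (Draws (suc t)) (exchange t s) (exchange t s′) →
            Setoid._≈_ (Draws (suc t)) s s′
          injective {x , r} {x′ , r′} (p , q) (p′ , q′) eq = Setoid.trans (Draws (suc t))
            (Setoid.sym (Draws (suc t)) (proj₁ (reverse t x r p q)))
            (Setoid.trans (Draws (suc t)) (exchange-cong t eq) (proj₁ (reverse t x′ r′ p′ q′)))

      exchange-≈ : ∀ {A B} → A Preserves _≐_ ⟶ _≡_ → B Preserves _≐_ ⟶ _≡_ →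
        (∀ x → Φ x ≡ false → A x ≡ false) → (∀ x → Φ x ≡ false → B x ≡ false) → ∀ t →
        Pr-after t A * E (λ x → ⟦ B x ⟧) ≈ Pr-after t B * E (λ x → ⟦ A x ⟧)
      exchange-≈ {A} {B} A-cong B-cong A⇒Φ B⇒Φ t = ≤-antisym
        (exchange-≤ (⟦⟧-cong A-cong) (⟦⟧-cong B-cong) A-0 B-0 t)
        (exchange-≤ (⟦⟧-cong B-cong) (⟦⟧-cong A-cong) B-0 A-0 t)
        where
        A-0 : ∀ x → Φ x ≡ false → ⟦ A x ⟧ ≈ 0#
        A-0 x Φx = reflexive (≡.cong ⟦_⟧ (A⇒Φ x Φx))
        B-0 : ∀ x → Φ x ≡ false → ⟦ B x ⟧ ≈ 0#
        B-0 x Φx = reflexive (≡.cong ⟦_⟧ (B⇒Φ x Φx))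

    accepted rejected : ℕ → Carrier
    accepted t = Pr-after t Φ
    rejected t = Pr-after t (not ∘ Φ)

    Φ̄-cong : (not ∘ Φ) Preserves _≐_ ⟶ _≡_
    Φ̄-cong x≐y = ≡.cong not (Φ-cong x≐y)

    -- Complementation is expressed by a sum for want of subtraction. At time 0 the identity also
    -- locates the probability of Φ, as the final division requires.
    accepted+rejected≈1 : ∀ t → accepted t + rejected t ≈ 1#
    accepted+rejected≈1 t = begin-equality
      accepted t + rejected t
        ≈⟨ E-+ F (expect-cong t (⟦⟧-cong Φ-cong)) (expect-cong t (⟦⟧-cong Φ̄-cong)) ⟨
      E (λ x → expect t (λ y → ⟦ Φ y ⟧) x + expect t (λ y → ⟦ not (Φ y) ⟧) x)
        ≈⟨ E-cong F (expect-distrib-+ t (⟦⟧-cong Φ-cong) (⟦⟧-cong Φ̄-cong)) ⟨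
      E (expect t (λ y → ⟦ Φ y ⟧ + ⟦ not (Φ y) ⟧))
        ≈⟨ E-cong F (λ x → expect-≈ t complement x) ⟩
      E (expect t (λ _ → 1#))
        ≈⟨ E-cong F (expect-const t 1#) ⟩
      E (λ _ → 1#)
        ≈⟨ E-const F 1# ⟩
      1# ∎
      where
      expect-≈ : ∀ t {f g} → (∀ x → f x ≈ g x) → ∀ x → expect t f x ≈ expect t g x
      expect-≈ t f≈g x = ≤-antisym (expect-mono t (≤-reflexive ∘ f≈g) x) (expect-mono t (≤-reflexive ∘ sym ∘ f≈g) x)
      complement : ∀ y → ⟦ Φ y ⟧ + ⟦ not (Φ y) ⟧ ≈ 1#
      complement y with Φ y
      ... | true  = +-identityʳ 1#
      ... | false = +-identityˡ 1#

    module _ (absorbing : ∀ x w → Φ x ≡ true → next x w ≐ x)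
             (z : Assignment) (k : ℕ) (reaches : ∀ x → Φ (orbit z k x) ≡ true) where

      expect-absorbed : ∀ t x → Φ x ≡ true → expect t (λ x → ⟦ Φ x ⟧) x ≈ 1#
      expect-absorbed zero    x Φx = reflexive (≡.cong ⟦_⟧ Φx)
      expect-absorbed (suc t) x Φx = trans
        (E-cong F λ w → expect-absorbed t (next x w) (≡.trans (Φ-cong (absorbing x w Φx)) Φx)) (E-const F 1#)

      hit : Carrier
      hit = power (𝒟 z) k

      -- A satisfying state stays satisfying. From any other state, `k` samples equal to `z` lead
      -- into Φ, an event of probability `hit`.
      expect-progress : ∀ x → ⟦ Φ x ⟧ + ⟦ not (Φ x) ⟧ * hit ≤ expect k (λ x → ⟦ Φ x ⟧) x
      expect-progress x with Φ x in Φx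
      ... | true  = ≤-reflexive (trans (trans (+-congˡ (zeroˡ hit)) (+-identityʳ 1#)) (sym (expect-absorbed k x Φx)))
      ... | false = begin
        0# + 1# * hit                               ≈⟨ trans (+-identityˡ _) (*-identityˡ hit) ⟩
        hit                                         ≈⟨ *-identityʳ hit ⟨
        hit * 1#                                    ≈⟨ *-congˡ (reflexive (≡.cong ⟦_⟧ (reaches x))) ⟨
        hit * ⟦ Φ (orbit z k x) ⟧                   ≤⟨ expect-orbit z k (λ x → ⟦ Φ x ⟧) x ⟩
        expect k (λ x → ⟦ Φ x ⟧) x                     ∎

      accepted-progress : ∀ t → accepted t + rejected t * hit ≤ accepted (t ℕ.+ k)
      accepted-progress t = begin
        accepted t + rejected t * hit
          ≈⟨ +-congˡ (trans (sym (E-*ʳ F _ hit)) (E-cong F λ x → sym (expect-*ʳ t _ hit x))) ⟩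
        accepted t + E (expect t (λ x → ⟦ not (Φ x) ⟧ * hit))
          ≈⟨ E-+ F (expect-cong t (⟦⟧-cong Φ-cong)) (expect-cong t (λ q → *-congʳ (⟦⟧-cong Φ̄-cong q))) ⟨
        E (λ x → expect t (λ x → ⟦ Φ x ⟧) x + expect t (λ x → ⟦ not (Φ x) ⟧ * hit) x)
          ≈⟨ E-cong F (expect-distrib-+ t (⟦⟧-cong Φ-cong) (λ q → *-congʳ (⟦⟧-cong Φ̄-cong q))) ⟨
        E (expect t (λ x → ⟦ Φ x ⟧ + ⟦ not (Φ x) ⟧ * hit))
          ≤⟨ E-mono F (expect-mono t expect-progress) ⟩
        E (expect t (expect k (λ x → ⟦ Φ x ⟧)))
          ≈⟨ E-cong F (λ x → expect-+ t k _ x) ⟨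
        accepted (t ℕ.+ k) ∎

-- Lower cuts as a semiring with sums

open import Defs
open ≡ using (refl; sym; trans; cong; subst; subst₂)

infix 4 _⊑_
_⊑_ : ℝ≥0∞ → ℝ≥0∞ → Set
x ⊑ y = ∀ q → Below x q → Below y q

down-≤ : ∀ x {q r} → q ℚ.≤ r → Below x r → Below x q
down-≤ x q≤r r<x = let (s , r<s , s<x) = rounded x r<x in down x (ℚ.≤-<-trans q≤r r<s) s<x

0⊑ : ∀ x → 𝟘 ⊑ x
0⊑ x q = negative x

⊕-below : ∀ x y {r s} → Below x r → Below y s → Below (x ⊕ y) (r ℚ.+ s)
⊕-below x y {r} {s} r<x s<y =
  let (r′ , r<r′ , r′<x) = rounded x r<x
  in r′ , s , r′<x , s<y , ℚ.+-monoˡ-< s r<r′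

*-mono-< : ∀ {p q r s} → 0ℚ ℚ.≤ p → 0ℚ ℚ.≤ r → p ℚ.< q → r ℚ.< s → p ℚ.* r ℚ.< q ℚ.* s
*-mono-< {p} {q} {r} {s} 0≤p 0≤r p<q r<s = ℚ.≤-<-trans
  (ℚ.*-monoˡ-≤-nonNeg p {{ℚ.nonNegative 0≤p}} (ℚ.<⇒≤ r<s))
  (ℚ.*-monoˡ-<-pos s {{ℚ.positive (ℚ.≤-<-trans 0≤r r<s)}} p<q)

⊗-below : ∀ x y {r s} → 0ℚ ℚ.≤ r → 0ℚ ℚ.≤ s → Below x r → Below y s → Below (x ⊗ y) (r ℚ.* s)
⊗-below x y 0≤r 0≤s r<x s<y =
  let (r′ , r<r′ , r′<x) = rounded x r<x
      (s′ , s<s′ , s′<y) = rounded y s<y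
  in inj₂ (r′ , s′ , ℚ.≤-trans 0≤r (ℚ.<⇒≤ r<r′) , ℚ.≤-trans 0≤s (ℚ.<⇒≤ s<s′) , r′<x , s′<y ,
           *-mono-< 0≤r 0≤s r<r′ s<s′)

⊕-monotone : ∀ {w x y z} → w ⊑ x → y ⊑ z → w ⊕ y ⊑ x ⊕ z
⊕-monotone w⊑x y⊑z q (r , s , r< , s< , q<) = r , s , w⊑x r r< , y⊑z s s< , q<

⊗-monotone : ∀ {w x y z} → w ⊑ x → y ⊑ z → w ⊗ y ⊑ x ⊗ z
⊗-monotone w⊑x y⊑z q (inj₁ q<0) = inj₁ q<0
⊗-monotone w⊑x y⊑z q (inj₂ (r , s , 0≤r , 0≤s , r< , s< , q<)) =
  inj₂ (r , s , 0≤r , 0≤s , w⊑x r r< , y⊑z s s< , q<)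

⊕-commutes : ∀ x y → x ⊕ y ⊑ y ⊕ x
⊕-commutes x y q (r , s , r<x , s<y , q<) = s , r , s<y , r<x , subst (q ℚ.<_) (ℚ.+-comm r s) q<

⊗-commutes : ∀ x y → x ⊗ y ⊑ y ⊗ x
⊗-commutes x y q (inj₁ q<0) = inj₁ q<0
⊗-commutes x y q (inj₂ (r , s , 0≤r , 0≤s , r<x , s<y , q<)) =
  inj₂ (s , r , 0≤s , 0≤r , s<y , r<x , subst (q ℚ.<_) (ℚ.*-comm r s) q<)

⊕-associates : ∀ x y z → (x ⊕ y) ⊕ z ⊑ x ⊕ (y ⊕ z)
⊕-associates x y z q (p , t , (r , s , r<x , s<y , p<r+s) , t<z , q<p+t) =
  down (x ⊕ (y ⊕ z)) (ℚ.<-trans q<p+t (subst (p ℚ.+ t ℚ.<_) (ℚ.+-assoc r s t) (ℚ.+-monoˡ-< t p<r+s)))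
    (⊕-below x (y ⊕ z) r<x (⊕-below y z s<y t<z))

⊕-associates⁻ : ∀ x y z → x ⊕ (y ⊕ z) ⊑ (x ⊕ y) ⊕ z
⊕-associates⁻ x y z q (r , p , r<x , (s , t , s<y , t<z , p<s+t) , q<r+p) =
  down ((x ⊕ y) ⊕ z)
    (ℚ.<-trans q<r+p (subst (r ℚ.+ p ℚ.<_) (sym (ℚ.+-assoc r s t)) (ℚ.+-monoʳ-< r p<s+t)))
    (⊕-below (x ⊕ y) z (⊕-below x y r<x s<y) t<z)

*-nonNeg : ∀ {p q} → 0ℚ ℚ.≤ p → 0ℚ ℚ.≤ q → 0ℚ ℚ.≤ p ℚ.* q
*-nonNeg {p} {q} 0≤p 0≤q = ℚ.nonNegative⁻¹ (p ℚ.* q)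
  {{ℚ.nonNeg*nonNeg⇒nonNeg p {{ℚ.nonNegative 0≤p}} q {{ℚ.nonNegative 0≤q}}}}

⊗-associates : ∀ x y z → (x ⊗ y) ⊗ z ⊑ x ⊗ (y ⊗ z)
⊗-associates x y z q (inj₁ q<0) = inj₁ q<0
⊗-associates x y z q (inj₂ (p , t , 0≤p , 0≤t , inj₁ p<0 , t<z , q<pt)) =
  contradiction (ℚ.<-≤-trans p<0 0≤p) (ℚ.<-irrefl refl)
⊗-associates x y z q (inj₂ (p , t , 0≤p , 0≤t , inj₂ (r , s , 0≤r , 0≤s , r<x , s<y , p<rs) , t<z , q<pt)) =
  down (x ⊗ (y ⊗ z)) (ℚ.<-≤-trans q<pt (subst (p ℚ.* t ℚ.≤_) (ℚ.*-assoc r s t)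
      (ℚ.*-monoʳ-≤-nonNeg t {{ℚ.nonNegative 0≤t}} (ℚ.<⇒≤ p<rs))))
    (⊗-below x (y ⊗ z) 0≤r (*-nonNeg 0≤s 0≤t) r<x (⊗-below y z 0≤s 0≤t s<y t<z))

⊗-associates⁻ : ∀ x y z → x ⊗ (y ⊗ z) ⊑ (x ⊗ y) ⊗ z
⊗-associates⁻ x y z q q< =
  ⊗-commutes z (x ⊗ y) q (⊗-monotone {z} {z} {y ⊗ x} {x ⊗ y} (λ _ p → p) (⊗-commutes y x) q
    (⊗-associates z y x q (⊗-commutes x (z ⊗ y) q
      (⊗-monotone {x} {x} {y ⊗ z} {z ⊗ y} (λ _ p → p) (⊗-commutes y z) q q<))))

⊕-increasingʳ : ∀ x y → y ⊑ x ⊕ y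
⊕-increasingʳ x y q q<y =
  let (r , q<r , r<y) = rounded y q<y
      -- The negative slack `q - r` lies below every `x`, and adding it to `s > r` still gives more
      -- than `q`.
      d = q ℚ.- r
      (s , r<s , s<y) = rounded y r<y
      q≡ : q ≡ d ℚ.+ r
      q≡ = solve 2 (λ q r → q := (q :- r) :+ r) refl q r
      d<0 : d ℚ.< 0ℚ
      d<0 = subst (d ℚ.<_) (ℚ.+-inverseʳ r) (ℚ.+-monoˡ-< (ℚ.- r) q<r)
  in d , s , negative x d<0 , s<y , subst (ℚ._< d ℚ.+ s) (sym q≡) (ℚ.+-monoʳ-< d r<s)
  where open +-*-Solver

⊕-increasingˡ : ∀ x y → x ⊑ x ⊕ y
⊕-increasingˡ x y q q<x = ⊕-commutes y x q (⊕-increasingʳ y x q q<x)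

𝟘⊕ : ∀ x → 𝟘 ⊕ x ⊑ x
𝟘⊕ x q (r , s , r<0 , s<x , q<r+s) =
  down x (ℚ.<-trans q<r+s (subst (r ℚ.+ s ℚ.<_) (ℚ.+-identityˡ s) (ℚ.+-monoˡ-< s r<0))) s<x

below-fraction : ∀ {q r} → 0ℚ ℚ.≤ q → q ℚ.< r → ∃[ s ] 0ℚ ℚ.≤ s × s ℚ.< 1ℚ × q ℚ.< s ℚ.* r
below-fraction {q} {r} 0≤q q<r =
  let (m , q<m , m<r) = ℚ.<-dense q<r
      instance
        r-pos = ℚ.positive (ℚ.≤-<-trans 0≤q q<r)
        r-nz  = ℚ.pos⇒nonZero r
        1/r-pos = ℚ.1/pos⇒pos r
      0≤m = ℚ.≤-trans 0≤q (ℚ.<⇒≤ q<m)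
      s = m ℚ.* (ℚ.1/ r)
      s*r≡m : s ℚ.* r ≡ m
      s*r≡m = trans (ℚ.*-assoc m (ℚ.1/ r) r) (trans (cong (m ℚ.*_) (ℚ.*-inverseˡ r)) (ℚ.*-identityʳ m))
  in s , *-nonNeg 0≤m (ℚ.<⇒≤ (ℚ.positive⁻¹ (ℚ.1/ r)))
       , subst (s ℚ.<_) (ℚ.*-inverseʳ r) (ℚ.*-monoˡ-<-pos (ℚ.1/ r) m<r)
       , subst (q ℚ.<_) (sym s*r≡m) q<m

𝟙⊗ : ∀ x → 𝟙 ⊗ x ⊑ x
𝟙⊗ x q (inj₁ q<0) = negative x q<0
𝟙⊗ x q (inj₂ (r , s , 0≤r , 0≤s , r<1 , s<x , q<rs)) =
  down x (ℚ.<-≤-trans q<rs (subst (r ℚ.* s ℚ.≤_) (ℚ.*-identityˡ s)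
    (ℚ.*-monoʳ-≤-nonNeg s {{ℚ.nonNegative 0≤s}} (ℚ.<⇒≤ r<1)))) s<x

𝟙⊗⁻ : ∀ x → x ⊑ 𝟙 ⊗ x
𝟙⊗⁻ x q q<x with q ℚ.<? 0ℚ
... | yes q<0 = inj₁ q<0
... | no  q≮0 =
  let 0≤q = ℚ.≮⇒≥ q≮0
      (r , q<r , r<x) = rounded x q<x
      (s , 0≤s , s<1 , q<sr) = below-fraction 0≤q q<r
  in inj₂ (s , r , 0≤s , ℚ.≤-trans 0≤q (ℚ.<⇒≤ q<r) , s<1 , r<x , q<sr)

𝟘⊗ : ∀ x → 𝟘 ⊗ x ⊑ 𝟘
𝟘⊗ x q (inj₁ q<0) = q<0
𝟘⊗ x q (inj₂ (r , s , 0≤r , 0≤s , r<0 , s<x , q<rs)) = contradiction (ℚ.<-≤-trans r<0 0≤r) (ℚ.<-irrefl refl)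

negative-+ : ∀ {r} s → r ℚ.< 0ℚ → r ℚ.+ s ℚ.< s
negative-+ {r} s r<0 = subst (r ℚ.+ s ℚ.<_) (ℚ.+-identityˡ s) (ℚ.+-monoˡ-< s r<0)

-- Products admit only nonnegative approximants, but one of the two approximants of `y ⊕ z` may be
-- negative. In that case the other one alone already exceeds `p`.
⊗-distributes : ∀ x y z → x ⊗ (y ⊕ z) ⊑ (x ⊗ y) ⊕ (x ⊗ z)
⊗-distributes x y z q (inj₁ q<0) = negative ((x ⊗ y) ⊕ (x ⊗ z)) q<0
⊗-distributes x y z q (inj₂ (r , p , 0≤r , 0≤p , r<x , (s , t , s<y , t<z , p<s+t) , q<rp))
  with s ℚ.<? 0ℚ | t ℚ.<? 0ℚ
... | yes s<0 | _ =
  let p<t = ℚ.<-trans p<s+t (negative-+ t s<0) in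
  ⊕-increasingʳ (x ⊗ y) (x ⊗ z) q (inj₂ (r , t , 0≤r , ℚ.≤-trans 0≤p (ℚ.<⇒≤ p<t) , r<x , t<z ,
    ℚ.<-≤-trans q<rp (ℚ.*-monoˡ-≤-nonNeg r {{ℚ.nonNegative 0≤r}} (ℚ.<⇒≤ p<t))))
... | no _ | yes t<0 =
  let p<s = ℚ.<-trans p<s+t (subst (ℚ._< s) (ℚ.+-comm t s) (negative-+ s t<0)) in
  ⊕-increasingˡ (x ⊗ y) (x ⊗ z) q (inj₂ (r , s , 0≤r , ℚ.≤-trans 0≤p (ℚ.<⇒≤ p<s) , r<x , s<y ,
    ℚ.<-≤-trans q<rp (ℚ.*-monoˡ-≤-nonNeg r {{ℚ.nonNegative 0≤r}} (ℚ.<⇒≤ p<s))))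
... | no s≮0 | no t≮0 =
  down ((x ⊗ y) ⊕ (x ⊗ z))
    (ℚ.<-≤-trans q<rp (subst (r ℚ.* p ℚ.≤_) (ℚ.*-distribˡ-+ r s t)
      (ℚ.*-monoˡ-≤-nonNeg r {{ℚ.nonNegative 0≤r}} (ℚ.<⇒≤ p<s+t))))
    (⊕-below (x ⊗ y) (x ⊗ z) (⊗-below x y 0≤r (ℚ.≮⇒≥ s≮0) r<x s<y) (⊗-below x z 0≤r (ℚ.≮⇒≥ t≮0) r<x t<z))

⊗-distributes⁻ : ∀ x y z → (x ⊗ y) ⊕ (x ⊗ z) ⊑ x ⊗ (y ⊕ z)
⊗-distributes⁻ x y z q (p₁ , p₂ , inj₁ p₁<0 , p₂< , q<) =
  ⊗-monotone {x} {x} {z} {y ⊕ z} (λ _ u → u) (⊕-increasingʳ y z) q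
    (down (x ⊗ z) (ℚ.<-trans q< (negative-+ p₂ p₁<0)) p₂<)
⊗-distributes⁻ x y z q (p₁ , p₂ , p₁<@(inj₂ _) , inj₁ p₂<0 , q<) =
  ⊗-monotone {x} {x} {y} {y ⊕ z} (λ _ u → u) (⊕-increasingˡ y z) q
    (down (x ⊗ y) (ℚ.<-trans q< (subst (ℚ._< p₁) (ℚ.+-comm p₂ p₁) (negative-+ p₁ p₂<0))) p₁<)
⊗-distributes⁻ x y z q (p₁ , p₂ , inj₂ (r₁ , s , 0≤r₁ , 0≤s , r₁<x , s<y , p₁<) ,
                                  inj₂ (r₂ , t , 0≤r₂ , 0≤t , r₂<x , t<z , p₂<) , q<) =
  -- The two products come with different approximants of `x`; the larger one serves for both.
  by-total (ℚ.≤-total r₁ r₂)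
  where
  conclude : ∀ r → Below x r → r₁ ℚ.≤ r → r₂ ℚ.≤ r → Below (x ⊗ (y ⊕ z)) q
  conclude r r<x r₁≤r r₂≤r = down (x ⊗ (y ⊕ z))
    (ℚ.<-≤-trans (ℚ.<-trans q< (ℚ.+-mono-< p₁< p₂<)) (subst ((r₁ ℚ.* s) ℚ.+ (r₂ ℚ.* t) ℚ.≤_)
      (sym (ℚ.*-distribˡ-+ r s t))
      (ℚ.+-mono-≤ (ℚ.*-monoʳ-≤-nonNeg s {{ℚ.nonNegative 0≤s}} r₁≤r)
                  (ℚ.*-monoʳ-≤-nonNeg t {{ℚ.nonNegative 0≤t}} r₂≤r))))
    (⊗-below x (y ⊕ z) (ℚ.≤-trans 0≤r₁ r₁≤r)
      (ℚ.nonNegative⁻¹ (s ℚ.+ t) {{ℚ.nonNeg+nonNeg⇒nonNeg s {{ℚ.nonNegative 0≤s}} t {{ℚ.nonNegative 0≤t}}}})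
      r<x (⊕-below y z s<y t<z))
  by-total : r₁ ℚ.≤ r₂ ⊎ r₂ ℚ.≤ r₁ → Below (x ⊗ (y ⊕ z)) q
  by-total (inj₁ r₁≤r₂) = conclude r₂ r₂<x r₁≤r₂ ℚ.≤-refl
  by-total (inj₂ r₂≤r₁) = conclude r₁ r₁<x ℚ.≤-refl r₂≤r₁

⊕-identity : ∀ x → 𝟘 ⊕ x ≈ x
⊕-identity x = 𝟘⊕ x , ⊕-increasingʳ 𝟘 x

⊕-comm : ∀ x y → x ⊕ y ≈ y ⊕ x
⊕-comm x y = ⊕-commutes x y , ⊕-commutes y x

⊗-comm : ∀ x y → x ⊗ y ≈ y ⊗ x
⊗-comm x y = ⊗-commutes x y , ⊗-commutes y x

≈-trans : ∀ {x y z} → x ≈ y → y ≈ z → x ≈ z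
≈-trans (p , p⁻) (q , q⁻) = (λ r u → q r (p r u)) , (λ r u → p⁻ r (q⁻ r u))

⊗-identity : ∀ x → 𝟙 ⊗ x ≈ x
⊗-identity x = 𝟙⊗ x , 𝟙⊗⁻ x

⊗-zero : ∀ x → 𝟘 ⊗ x ≈ 𝟘
⊗-zero x = 𝟘⊗ x , 0⊑ (𝟘 ⊗ x)

⊗-distrib : ∀ x y z → x ⊗ (y ⊕ z) ≈ (x ⊗ y) ⊕ (x ⊗ z)
⊗-distrib x y z = ⊗-distributes x y z , ⊗-distributes⁻ x y z

⊕-cong : ∀ {w x y z} → w ≈ x → y ≈ z → w ⊕ y ≈ x ⊕ z
⊕-cong {w} {x} {y} {z} (p , p⁻) (q , q⁻) = ⊕-monotone {w} {x} {y} {z} p q , ⊕-monotone {x} {w} {z} {y} p⁻ q⁻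

⊗-cong : ∀ {w x y z} → w ≈ x → y ≈ z → w ⊗ y ≈ x ⊗ z
⊗-cong {w} {x} {y} {z} (p , p⁻) (q , q⁻) = ⊗-monotone {w} {x} {y} {z} p q , ⊗-monotone {x} {w} {z} {y} p⁻ q⁻

ℝ-commutativeSemiring : CommutativeSemiring (lsuc 0ℓ) 0ℓ
ℝ-commutativeSemiring = record
  { Carrier = ℝ≥0∞
  ; _≈_ = _≈_
  ; _+_ = _⊕_
  ; _*_ = _⊗_
  ; 0#  = 𝟘
  ; 1#  = 𝟙
  ; isCommutativeSemiring = record
    { isSemiring = record
      { isSemiringWithoutAnnihilatingZero = record
        { +-isCommutativeMonoid = record
          { isMonoid = record
            { isSemigroup = record
              { isMagma = record
                { isEquivalence = ≈-isEquivalence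
                ; ∙-cong = λ {w} {x} {y} {z} → ⊕-cong {w} {x} {y} {z} }
              ; assoc = λ x y z → ⊕-associates x y z , ⊕-associates⁻ x y z }
            ; identity = ⊕-identity , λ x → ≈-trans {x ⊕ 𝟘} {𝟘 ⊕ x} {x} (⊕-comm x 𝟘) (⊕-identity x) }
          ; comm = ⊕-comm }
        ; *-cong = λ {w} {x} {y} {z} → ⊗-cong {w} {x} {y} {z}
        ; *-assoc = λ x y z → ⊗-associates x y z , ⊗-associates⁻ x y z
        ; *-identity = ⊗-identity , λ x → ≈-trans {x ⊗ 𝟙} {𝟙 ⊗ x} {x} (⊗-comm x 𝟙) (⊗-identity x)
        ; distrib = ⊗-distrib , λ x y z →
            ≈-trans {(y ⊕ z) ⊗ x} {x ⊗ (y ⊕ z)} {(y ⊗ x) ⊕ (z ⊗ x)} (⊗-comm (y ⊕ z) x)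
            (≈-trans {x ⊗ (y ⊕ z)} {(x ⊗ y) ⊕ (x ⊗ z)} {(y ⊗ x) ⊕ (z ⊗ x)} (⊗-distrib x y z)
              (⊕-cong {x ⊗ y} {y ⊗ x} {x ⊗ z} {z ⊗ x} (⊗-comm x y) (⊗-comm x z))) }
      ; zero = ⊗-zero , λ x → ≈-trans {x ⊗ 𝟘} {𝟘 ⊗ x} {𝟘} (⊗-comm x 𝟘) (⊗-zero x) }
    ; *-comm = ⊗-comm }
  }
  where
  ≈-isEquivalence : IsEquivalence _≈_
  ≈-isEquivalence = record
    { refl  = (λ _ u → u) , (λ _ u → u)
    ; sym   = λ (p , q) → q , p
    ; trans = λ {x} {y} {z} → ≈-trans {x} {y} {z}
    }

ℝ-∑-semiring : ∑-Semiring
ℝ-∑-semiring = record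
  { commutativeSemiring = ℝ-commutativeSemiring
  ; _≤_ = _⊑_
  ; ≤-isPartialOrder = record
    { isPreorder = record
      { isEquivalence = CommutativeSemiring.isEquivalence ℝ-commutativeSemiring
      ; reflexive     = proj₁
      ; trans         = λ p q r u → q r (p r u) }
    ; antisym = _,_ }
  ; 0≤ = 0⊑
  ; +-mono = λ {w} {x} {y} {z} → ⊕-monotone {w} {x} {y} {z}
  ; *-mono = λ {w} {x} {y} {z} → ⊗-monotone {w} {x} {y} {z}
  ; ∑ = ∑
  ; ∑-upper = λ S g {l} l! q q< → l , l! , q<
  -- A rational below the affine expression involves only one finite list. If the factor's part is
  -- negative, no list is provided and the empty one does.
  ; ∑-least = λ S g bound q → λ where
      (r , s , inj₁ r<0 , s<b , q<) → bound [] [] q (r , s , inj₁ r<0 , s<b , q<)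
      (r , s , inj₂ (u , v , 0≤u , 0≤v , u<a , (l , l! , v<) , r<) , s<b , q<) →
        bound l l! q (r , s , inj₂ (u , v , 0≤u , 0≤v , u<a , v< , r<) , s<b , q<)
  }

-- Positivity, convergence to 1, and division

positive-⊗ : ∀ x y → Positive x → Positive y → Positive (x ⊗ y)
positive-⊗ x y 0<x 0<y = down-≤ (x ⊗ y) ℚ.≤-refl (⊗-below x y {0ℚ} {0ℚ} ℚ.≤-refl ℚ.≤-refl 0<x 0<y)

positive-⊗⁻ : ∀ x y → Positive (x ⊗ y) → Positive x × Positive y
positive-⊗⁻ x y (inj₁ 0<0) = contradiction 0<0 (ℚ.<-irrefl refl)
positive-⊗⁻ x y (inj₂ (r , s , 0≤r , 0≤s , r<x , s<y , _)) = down-≤ x 0≤r r<x , down-≤ y 0≤s s<y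

-- Cuts cannot be compared effectively, but the sign of the rational `r` decides which summand is
-- positive.
positive-⊕⁻ : ∀ x y → Positive (x ⊕ y) → Positive x ⊎ Positive y
positive-⊕⁻ x y (r , s , r<x , s<y , 0<r+s) with r ℚ.<? 0ℚ
... | yes r<0 = inj₂ (down y (ℚ.<-trans 0<r+s (negative-+ s r<0)) s<y)
... | no  r≮0 = inj₁ (down-≤ x (ℚ.≮⇒≥ r≮0) r<x)

-- Positivity is witnessed by a finite list, so a positive term can be searched for. Applied to
-- Pr(Φ), this yields the satisfying assignment `z` of positive mass.
positive-term : ∀ S g → Positive (∑ S g) → ∃[ s ] Positive (g s)
positive-term S g (l , _ , 0<l) = go l 0<l
  where
  go : ∀ l → Positive (List.foldr _⊕_ 𝟘 (List.map g l)) → ∃[ s ] Positive (g s)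
  go []      0<0 = contradiction 0<0 (ℚ.<-irrefl refl)
  go (s ∷ l) 0<  with positive-⊕⁻ (g s) (List.foldr _⊕_ 𝟘 (List.map g l)) 0<
  ... | inj₁ 0<s = s , 0<s
  ... | inj₂ 0<l = go l 0<l

multiple : ℕ → ℚ → ℚ
multiple zero    q = 0ℚ
multiple (suc k) q = q ℚ.+ multiple k q

-- Among unnormalised rationals all multiples keep the denominator of `q`, so no cancellation has to
-- be tracked.
toℚᵘ-multiple : ∀ k q → toℚᵘ (multiple k q) ℚᵘ.≃ ℚᵘ.mkℚᵘ (ℤ.+ k ℤ.* ℚ.↥ q) (ℚ.denominator-1 q)
toℚᵘ-multiple zero    q = ℚᵘ.*≡* refl
toℚᵘ-multiple (suc k) q@record{} = ℚᵘ.≃-trans (ℚ.toℚᵘ-homo-+ q (multiple k q))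
  (ℚᵘ.≃-trans (ℚᵘ.+-congʳ (toℚᵘ q) (toℚᵘ-multiple k q)) (ℚᵘ.*≡* (identity (ℚ.↥ q) (ℤ.+ k) (ℚ.↧ q))))
  where
  identity : ∀ n k d → (n ℤ.* d ℤ.+ (k ℤ.* n) ℤ.* d) ℤ.* d ≡ ((ℤ.+ 1 ℤ.+ k) ℤ.* n) ℤ.* (d ℤ.* d)
  identity = solve-∀

-- For `q = (n + 1) / (d + 1)`, adding `d + 1` copies gives `n + 1`.
archimedean : ∀ q → 0ℚ ℚ.< q → ∃[ k ] 1ℚ ℚ.≤ multiple k q
archimedean q@(mkℚ (ℤ.+ suc n) d _) _ = suc d , ℚ.toℚᵘ-cancel-≤
  (ℚᵘ.≤-trans (ℚᵘ.*≤* le) (ℚᵘ.≤-reflexive (ℚᵘ.≃-sym (toℚᵘ-multiple (suc d) q))))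
  where
  le : ℤ.+ 1 ℤ.* ℤ.+ suc d ℤ.≤ (ℤ.+ suc d ℤ.* ℤ.+ suc n) ℤ.* ℤ.+ 1
  le = subst₂ ℤ._≤_ (ℤ.*-comm (ℤ.+ suc d) (ℤ.+ 1)) (sym (ℤ.*-identityʳ _))
    (ℤ.*-monoˡ-≤-nonNeg (ℤ.+ suc d) {ℤ.+ 1} {ℤ.+ suc n} (ℤ.+≤+ (ℕ.s≤s ℕ.z≤n)))

archimedean (mkℚ (ℤ.+ 0) d _)    (ℚ.*<* (ℤ.+<+ ()))
archimedean (mkℚ ℤ.-[1+ n ] d _) (ℚ.*<* ())

module _ (a b : ℕ → ℝ≥0∞) (p : ℝ≥0∞) (k : ℕ) (p-positive : Positive p)
  (a⊕b≈𝟙 : ∀ t → a t ⊕ b t ≈ 𝟙) (progress : ∀ t → a t ⊕ b t ⊗ p ⊑ a (t ℕ.+ k)) where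

  -- While a t has not reached c, b t exceeds a fixed positive amount,
  -- so k further steps add a fixed positive amount to a.
  a-approaches-1 : ∀ {c} → c ℚ.< 1ℚ → ∃[ t ] Below (a t) c
  a-approaches-1 {c} c<1 =
    let (c′ , c<c′ , c′<1) = ℚ.<-dense c<1
        (π , 0<π , π<p) = rounded p p-positive
        δ = c′ ℚ.- c
        0<δ = subst (ℚ._< δ) (ℚ.+-inverseʳ c) (ℚ.+-monoˡ-< (ℚ.- c) c<c′)
        η = δ ℚ.* π
        0<η = subst (ℚ._< η) (ℚ.*-zeroˡ 0ℚ) (*-mono-< ℚ.≤-refl ℚ.≤-refl 0<δ 0<π)
        (j , 1≤jη) = archimedean η 0<η
    in finish c′ c′<1 π (ℚ.<⇒≤ 0<π) π<p (ℚ.<⇒≤ 0<δ) j 1≤jη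
    where
    module _ c′ (c′<1 : c′ ℚ.< 1ℚ) π (0≤π : 0ℚ ℚ.≤ π) (π<p : Below p π) (0≤δ : 0ℚ ℚ.≤ c′ ℚ.- c) where
      η = (c′ ℚ.- c) ℚ.* π

      -- Reading `a t ⊕ b t ≈ 𝟙` at `c′` gives rationals with `c′ < r + s`. Comparing `r` with `c`
      -- decides whether `a t` has reached `c` or `b t` exceeds `c′ - c`.
      climb : ∀ {q} t → Below (a t) q → Below (a t) c ⊎ Below (a (t ℕ.+ k)) (η ℚ.+ q)
      climb {q} t q<a with proj₂ (a⊕b≈𝟙 t) c′ c′<1
      ... | r , s , r<a , s<b , c′<r+s with r ℚ.<? c
      ...   | no  r≮c = inj₁ (down-≤ (a t) (ℚ.≮⇒≥ r≮c) r<a)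
      ...   | yes r<c = inj₂ (progress t (η ℚ.+ q) (subst (Below (a t ⊕ b t ⊗ p)) (ℚ.+-comm q η)
                (⊕-below (a t) (b t ⊗ p) q<a (⊗-below (b t) p 0≤δ 0≤π (down (b t) δ<s s<b) π<p))))
        where
        δ<s : c′ ℚ.- c ℚ.< s
        δ<s = subst (c′ ℚ.- c ℚ.<_) (solve 2 (λ c s → (c :+ s) :- c := s) refl c s)
          (ℚ.+-monoˡ-< (ℚ.- c) (ℚ.<-trans c′<r+s (ℚ.+-monoˡ-< s r<c)))
          where open +-*-Solver

      climbs : ∀ j {q} t → Below (a t) q → ∃[ t′ ] (Below (a t′) c ⊎ Below (a t′) (multiple j η ℚ.+ q))
      climbs zero    {q} t q<a = t , inj₂ (subst (Below (a t)) (sym (ℚ.+-identityˡ q)) q<a)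
      climbs (suc j) {q} t q<a with climbs j t q<a
      ... | t′ , inj₁ c<a = t′ , inj₁ c<a
      ... | t′ , inj₂ q′<a with climb t′ q′<a
      ...   | inj₁ c<a  = t′ , inj₁ c<a
      ...   | inj₂ q″<a = t′ ℕ.+ k , inj₂
            (subst (Below (a (t′ ℕ.+ k))) (sym (ℚ.+-assoc η (multiple j η) q)) q″<a)

      finish : ∀ j → 1ℚ ℚ.≤ multiple j η → ∃[ t ] Below (a t) c
      -- The negative number `c - 1` is below `a 0` for free, and increments totalling at least 1
      -- lift it to `c`.
      finish j 1≤jη with climbs j {c ℚ.- 1ℚ} 0 (negative (a 0)
        (subst (c ℚ.- 1ℚ ℚ.<_) (ℚ.+-inverseʳ 1ℚ) (ℚ.+-monoˡ-< (ℚ.- 1ℚ) c<1)))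
      ... | t , inj₁ c<a = t , c<a
      ... | t , inj₂ q<a = t , down-≤ (a t) (subst (ℚ._≤ multiple j η ℚ.+ (c ℚ.- 1ℚ))
        (solve 1 (λ c → con 1ℚ :+ (c :- con 1ℚ) := c) refl c) (ℚ.+-monoˡ-≤ (c ℚ.- 1ℚ) 1≤jη)) q<a
        where open +-*-Solver

  ⨆a≈𝟙 : ⨆ a ≈ 𝟙
  ⨆a≈𝟙 = (λ q (t , q<a) → proj₁ (a⊕b≈𝟙 t) q (⊕-increasingˡ (a t) (b t) q q<a)) , (λ q → a-approaches-1)

-- y is located because y ⊕ y′ ≈ 𝟙, so it has a lower approximation s within a factor q₂ / q₁ of y.
⊗⇒⊘ : ∀ {u x y y′} → Positive y → y ⊕ y′ ≈ 𝟙 → u ⊗ y ≈ x → u ≈ x ⊘ y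
⊗⇒⊘ {u} {x} {y} {y′} 0<y y⊕y′≈𝟙 uy≈x = to , from
  where
  -- Any `s′` below `y′` makes `1 - s′` an upper bound of `y`; choosing `s + s′ > 1 - δ` puts this
  -- bound within `δ` of `s`.
  approximation : ∀ {δ} → 0ℚ ℚ.< δ → ∃[ s ] Below y s × (∀ t → Below y t → t ℚ.≤ s ℚ.+ δ)
  approximation {δ} 0<δ
    with proj₂ y⊕y′≈𝟙 (1ℚ ℚ.- δ)
      (subst (1ℚ ℚ.- δ ℚ.<_) (ℚ.+-identityʳ 1ℚ) (ℚ.+-monoʳ-< 1ℚ (ℚ.neg-antimono-< 0<δ)))
  ... | s , s′ , s<y , s′<y′ , 1-δ<s+s′ = s , s<y , λ t t<y → ℚ.<⇒≤ (subst₂ ℚ._<_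
      (solve 2 (λ t s′ → (t :+ s′) :- s′ := t) refl t s′)
      (solve 3 (λ s s′ δ → (s :+ s′) :+ (δ :- s′) := s :+ δ) refl s s′ δ)
      (ℚ.<-trans (ℚ.+-monoˡ-< (ℚ.- s′) (proj₁ y⊕y′≈𝟙 (t ℚ.+ s′) (⊕-below y y′ t<y s′<y′)))
        (subst (ℚ._< (s ℚ.+ s′) ℚ.+ (δ ℚ.- s′))
          (solve 2 (λ s′ δ → (con 1ℚ :- δ) :+ (δ :- s′) := con 1ℚ :- s′) refl s′ δ)
          (ℚ.+-monoˡ-< (δ ℚ.- s′) 1-δ<s+s′))))
    where
    open +-*-Solver

  to : u ⊑ x ⊘ y
  to q q<u with q ℚ.<? 0ℚ
  ... | yes q<0 = inj₁ q<0
  ... | no  q≮0 =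
    let (q₂ , q<q₂ , q₂<u) = rounded u q<u
        (q₁ , q<q₁ , q₁<q₂) = ℚ.<-dense q<q₂
        0≤q = ℚ.≮⇒≥ q≮0
        0<q₁ = ℚ.≤-<-trans 0≤q q<q₁
        0<q₂ = ℚ.<-trans 0<q₁ q₁<q₂
        (e , 0<e , e<y) = rounded y 0<y
        d = q₂ ℚ.- q₁
        0<d : 0ℚ ℚ.< d
        0<d = subst (ℚ._< d) (ℚ.+-inverseʳ q₁) (ℚ.+-monoˡ-< (ℚ.- q₁) q₁<q₂)
        instance
          q₁-positive   = ℚ.positive 0<q₁
          q₁-nonZero    = ℚ.pos⇒nonZero q₁
          1/q₁-positive = ℚ.1/pos⇒pos q₁
        -- Chosen so that `q₁ δ = (q₂ - q₁) e`. The gap between `q₁` and `q₂` then absorbs the error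
        -- of `s₀`, provided that the approximant is at least `e`; hence the maximum `s` of `s₀` and
        -- `e`.
        δ = ℚ.1/ q₁ ℚ.* (d ℚ.* e)
        0<de : 0ℚ ℚ.< d ℚ.* e
        0<de = subst (ℚ._< d ℚ.* e) (ℚ.*-zeroˡ 0ℚ) (*-mono-< ℚ.≤-refl ℚ.≤-refl 0<d 0<e)
        0<δ : 0ℚ ℚ.< δ
        0<δ = subst (ℚ._< δ) (ℚ.*-zeroˡ 0ℚ) (*-mono-< ℚ.≤-refl ℚ.≤-refl (ℚ.positive⁻¹ (ℚ.1/ q₁)) 0<de)
        q₁δ≡de : q₁ ℚ.* δ ≡ d ℚ.* e
        q₁δ≡de = trans (sym (ℚ.*-assoc q₁ (ℚ.1/ q₁) (d ℚ.* e)))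
                   (trans (cong (ℚ._* (d ℚ.* e)) (ℚ.*-inverseʳ q₁)) (ℚ.*-identityˡ (d ℚ.* e)))
        (s₀ , s₀<y , close) = approximation 0<δ
        s = s₀ ℚ.⊔ e
        s<y : Below y s
        s<y = ⊔-below s₀<y e<y
        e≤s = ℚ.p≤q⊔p s₀ e
        s≥0 = ℚ.≤-trans (ℚ.<⇒≤ 0<e) e≤s
        bound : ∀ t → Below y t → q₁ ℚ.* t ℚ.≤ q₂ ℚ.* s
        bound t t<y = begin
          q₁ ℚ.* t                    ≤⟨ ℚ.*-monoˡ-≤-nonNeg q₁ {{ℚ.pos⇒nonNeg q₁}} (close t t<y) ⟩
          q₁ ℚ.* (s₀ ℚ.+ δ)           ≡⟨ ℚ.*-distribˡ-+ q₁ s₀ δ ⟩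
          q₁ ℚ.* s₀ ℚ.+ q₁ ℚ.* δ      ≡⟨ cong (q₁ ℚ.* s₀ ℚ.+_) q₁δ≡de ⟩
          q₁ ℚ.* s₀ ℚ.+ d ℚ.* e       ≤⟨ ℚ.+-mono-≤
              (ℚ.*-monoˡ-≤-nonNeg q₁ {{ℚ.pos⇒nonNeg q₁}} (ℚ.p≤p⊔q s₀ e))
              (ℚ.*-monoˡ-≤-nonNeg d {{ℚ.nonNegative (ℚ.<⇒≤ 0<d)}} e≤s) ⟩
          q₁ ℚ.* s ℚ.+ d ℚ.* s        ≡⟨ solve 3 (λ q₁ q₂ s → q₁ :* s :+ (q₂ :- q₁) :* s := q₂ :* s) refl q₁ q₂ s ⟩
          q₂ ℚ.* s                    ∎
    in inj₂ (q₁ , q₂ ℚ.* s , q<q₁ ,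
             proj₁ uy≈x (q₂ ℚ.* s) (⊗-below u y (ℚ.<⇒≤ 0<q₂) s≥0 q₂<u s<y) , bound)
    where
    open +-*-Solver
    open ℚ.≤-Reasoning
    ⊔-below : ∀ {r s} → Below y r → Below y s → Below y (r ℚ.⊔ s)
    ⊔-below {r} {s} r<y s<y with ℚ.≤-total r s
    ... | inj₁ r≤s = subst (Below y) (sym (ℚ.p≤q⇒p⊔q≡q r≤s)) s<y
    ... | inj₂ s≤r = subst (Below y) (sym (ℚ.p≥q⇒p⊔q≡p s≤r)) r<y

  from : x ⊘ y ⊑ u
  from q (inj₁ q<0) = negative u q<0
  from q (inj₂ (q′ , r , q<q′ , r<x , bound)) with proj₂ uy≈x r r<x
  -- A positive `e` below `y` turns `q′ e ≤ r < 0` into `q′ < 0`, so `q` is negative and lies below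
  -- every cut.
  ... | inj₁ r<0 =
    let (e , 0<e , e<y) = rounded y 0<y
        q′<0 = ℚ.*-cancelʳ-<-nonNeg e {{ℚ.nonNegative (ℚ.<⇒≤ 0<e)}}
                 (subst (q′ ℚ.* e ℚ.<_) (sym (ℚ.*-zeroˡ e)) (ℚ.≤-<-trans (bound e e<y) r<0))
    in negative u (ℚ.<-trans q<q′ q′<0)
  ... | inj₂ (v , s , _ , 0≤s , v<u , s<y , r<vs) =
    down u (ℚ.<-trans q<q′ (ℚ.*-cancelʳ-<-nonNeg s {{ℚ.nonNegative 0≤s}} (ℚ.≤-<-trans (bound s s<y) r<vs))) v<u

-- Violated clauses along a run

and-tabulate⁺ : ∀ {m} (p : Fin m → Bool) → (∀ k → p k ≡ true) → and (List.tabulate p) ≡ true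
and-tabulate⁺ {zero}  p all = ≡.refl
and-tabulate⁺ {suc m} p all = ≡.cong₂ _∧_ (all zero) (and-tabulate⁺ (p ∘ suc) (all ∘ suc))

and-tabulate⁻ : ∀ {m} (p : Fin m → Bool) → and (List.tabulate p) ≡ true → ∀ k → p k ≡ true
and-tabulate⁻ p eq zero    with p zero
... | true = ≡.refl
and-tabulate⁻ p eq (suc k) with p zero
... | true = and-tabulate⁻ (p ∘ suc) eq k

splice-∈ : ∀ {n} {D : Fin n → Set} {S : Subset n} (w x : ∀ i → D i) {i} → i ∈ S → splice S w x i ≡ w i
splice-∈ {S = S} w x {i} i∈S with i ∈? S
... | yes _  = ≡.refl
... | no i∉S = contradiction i∈S i∉S

splice-∉ : ∀ {n} {D : Fin n → Set} {S : Subset n} (w x : ∀ i → D i) {i} → i ∉ S → splice S w x i ≡ x i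
splice-∉ {S = S} w x {i} i∉S with i ∈? S
... | yes i∈S = contradiction i∈S i∉S
... | no _    = ≡.refl

true≢false : true ≢ false
true≢false ()

module Clauses {n m} (I : Instance n m) (f : Choice m) where
  open Instance I

  clause-cong : ∀ k → clause k Preserves _≐_ ⟶ _≡_
  clause-cong k x≐y = clause-local k _ _ λ i _ → x≐y i

  violated-≡ : ∀ {x y} → (∀ k → clause k x ≡ clause k y) → violated x ≡ violated y
  violated-≡ eq = Vec.tabulate-cong λ k → ≡.cong not (eq k)

  Φ-≡ : ∀ {x y} → (∀ k → clause k x ≡ clause k y) → Φ x ≡ Φ y
  Φ-≡ {x} {y} eq = ≡.cong and (tabulate-cong eq)
    where
    tabulate-cong : ∀ {k} {p q : Fin k → Bool} → (∀ i → p i ≡ q i) → List.tabulate p ≡ List.tabulate q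
    tabulate-cong {zero}  eq = ≡.refl
    tabulate-cong {suc k} eq = ≡.cong₂ List._∷_ (eq zero) (tabulate-cong (eq ∘ suc))

  Φ-cong : Φ Preserves _≐_ ⟶ _≡_
  Φ-cong x≐y = Φ-≡ λ k → clause-cong k x≐y

  Φ⇒clause : ∀ {x} → Φ x ≡ true → ∀ k → clause k x ≢ false
  Φ⇒clause Φx k eq = true≢false (≡.trans (≡.sym (and-tabulate⁻ _ Φx k)) eq)

  -- Factoring the scope through the violated set makes states with equal violated sets resample
  -- equal scopes. The empty set is sent to the empty scope, which freezes satisfying assignments.
  resampled : Subset m → Subset n
  resampled N with nonempty? N
  ... | yes ne = Scp (choose f N ne)
  ... | no  _  = ⊥

  scope : Assignment → Subset n
  scope x = resampled (violated x)

  scope-≡ : ∀ {x y} → (∀ k → clause k x ≡ clause k y) → scope x ≡ scope y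
  scope-≡ eq = ≡.cong resampled (violated-≡ eq)

  scope-cong : ∀ {x y} → x ≐ y → scope x ≡ scope y
  scope-cong x≐y = scope-≡ λ k → clause-cong k x≐y

  ∈-violated⁻ : ∀ {x k} → k ∈ violated x → clause k x ≡ false
  ∈-violated⁻ {x} {k} k∈ = Bool.not-injective (≡.trans (≡.sym (Vec.lookup∘tabulate _ k)) (Vec.[]=⇒lookup k∈))

  ∈-violated⁺ : ∀ {x k} → clause k x ≡ false → k ∈ violated x
  ∈-violated⁺ {x} {k} eq = Vec.lookup⇒[]= k _ (≡.trans (Vec.lookup∘tabulate _ k) (≡.cong not eq))

  scope-view : ∀ x → (Φ x ≡ true × scope x ≡ ⊥) ⊎ ∃[ ℓ ] clause ℓ x ≡ false × scope x ≡ Scp ℓ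
  scope-view x with nonempty? (violated x)
  ... | yes ne = inj₂ (choose f _ ne , ∈-violated⁻ (choose-∈ f _ ne) , ≡.refl)
  ... | no ¬ne = inj₁ (and-tabulate⁺ _ (λ k → Bool.¬-not λ eq → ¬ne (k , ∈-violated⁺ eq)) , ≡.refl)

  open Dynamics D scope scope-cong

  next-∉ : ∀ x w {i} → i ∉ scope x → next x w i ≡ x i
  next-∉ x w = splice-∉ w x

  absorbing : ∀ x w → Φ x ≡ true → next x w ≐ x
  absorbing x w Φx i with scope-view x
  ... | inj₁ (_ , scope≡⊥)  = next-∉ x w (≡.subst (i ∉_) (≡.sym scope≡⊥) ∉⊥)
  ... | inj₂ (ℓ , ℓ-bad , _) = contradiction ℓ-bad (Φ⇒clause Φx ℓ)

  module _ (z : Assignment) (Φz : Φ z ≡ true) where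
    differ : Assignment → Subset n
    differ x = Vec.tabulate λ i → not (does (x i ≟ z i))

    ∈-differ⁺ : ∀ {x i} → x i ≢ z i → i ∈ differ x
    ∈-differ⁺ {x} {i} x≢z = Vec.lookup⇒[]= i _
      (≡.trans (Vec.lookup∘tabulate _ i) (≡.cong not (dec-false (x i ≟ z i) x≢z)))

    ∈-differ⁻ : ∀ {x i} → i ∈ differ x → x i ≢ z i
    ∈-differ⁻ {x} {i} i∈ x≡z = true≢false (≡.trans (≡.sym (Vec.[]=⇒lookup i∈))
      (≡.trans (Vec.lookup∘tabulate _ i) (≡.cong not (dec-true (x i ≟ z i) x≡z))))

    orbit-Φ : ∀ t x → Φ x ≡ true → Φ (orbit z t x) ≡ true
    orbit-Φ zero    x Φx = Φx
    orbit-Φ (suc t) x Φx = orbit-Φ t (next x z) (≡.trans (Φ-cong (absorbing x z Φx)) Φx)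

    -- The clause `ℓ` fails at `x` and holds at `z`, so the two disagree somewhere in its scope,
    -- where the sample `z` now removes the disagreement.
    differ-⊂ : ∀ x ℓ → clause ℓ x ≡ false → scope x ≡ Scp ℓ → differ (next x z) ⊂ differ x
    differ-⊂ x ℓ ℓ-bad scope≡ = smaller , strict
      where
      smaller : differ (next x z) ⊆ differ x
      smaller {i} i∈ with i ∈? scope x
      ... | yes i∈S = contradiction (splice-∈ z x i∈S) (∈-differ⁻ i∈)
      ... | no  i∉S = ∈-differ⁺ λ x≡z → ∈-differ⁻ i∈ (≡.trans (next-∉ x z i∉S) x≡z)
      strict : ∃[ i ] i ∈ differ x × i ∉ differ (next x z)
      strict with Fin.any? (λ i → (i ∈? differ x) ×-dec (i ∈? Scp ℓ))
      ... | yes (i , i∈ , i∈ℓ) = i , i∈ , λ i∈′ →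
        ∈-differ⁻ i∈′ (splice-∈ z x (≡.subst (i ∈_) (≡.sym scope≡) i∈ℓ))
      ... | no  none = contradiction
        (≡.trans (clause-local ℓ z x agree) ℓ-bad) (Φ⇒clause Φz ℓ)
        where
        agree : ∀ i → i ∈ Scp ℓ → z i ≡ x i
        agree i i∈ℓ with x i ≟ z i
        ... | yes x≡z = ≡.sym x≡z
        ... | no  x≢z = contradiction (i , ∈-differ⁺ x≢z , i∈ℓ) none

    orbit-reaches : ∀ t x → ∣ differ x ∣ ℕ.≤ t → Φ (orbit z t x) ≡ true
    orbit-reaches t x ∣x∣≤t with scope-view x
    ... | inj₁ (Φx , _) = orbit-Φ t x Φx
    ... | inj₂ (ℓ , ℓ-bad , scope≡) with t | ℕ.<-≤-trans (p⊂q⇒∣p∣<∣q∣ (differ-⊂ x ℓ ℓ-bad scope≡)) ∣x∣≤t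
    ...   | suc t′ | s≤s le = orbit-reaches t′ (next x z) le

    reaches : ∀ x → Φ (orbit z n x) ≡ true
    reaches x = orbit-reaches n x (∣p∣≤n (differ x))

  module _ (_∼_ : Rel (Fin m) 0ℓ) (axiom1 : Axiom1 I _∼_) (axiom2 : Axiom2 I _∼_) where

    -- Axiom 1 is used in contraposition: clauses violated together are unrelated by `∼`, so Axiom 2
    -- applies whenever they are distinct.
    violation-persists : ∀ {k ℓ x x′} → clause k x ≡ false → clause ℓ x ≡ false →
      (∀ i → i ∉ Scp ℓ → x i ≡ x′ i) → k ≡ ℓ ⊎ ∃[ k′ ] Scp k ⊆ Scp k′ × clause k′ x′ ≡ false
    violation-persists {k} {ℓ} {x} {x′} k-bad ℓ-bad agree with k Fin.≟ ℓ
    ... | yes k≡ℓ = inj₁ k≡ℓ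
    ... | no  k≢ℓ = inj₂ (axiom2 k ℓ k≢ℓ
      (λ k∼ℓ → true≢false (≡.trans (≡.sym (axiom1 k ℓ k∼ℓ x)) (≡.cong₂ _∨_ k-bad ℓ-bad)))
      x x′ k-bad ℓ-bad agree)

    Touched : ∀ t → Assignment → Setoid.Carrier (Draws t) → Fin n → Set
    Touched zero    x z       i = Data.Empty.⊥
    Touched (suc t) x (w , r) i = i ∈ scope x ⊎ Touched t (next x w) r i

    -- A violation can be followed through the run. Each iteration either resamples the violated
    -- clause or hands the violation on to a clause whose scope contains the old one. None is left
    -- at the end, so at some time a scope containing `Scp k` was resampled.
    violated⇒touched : ∀ t x r → Φ (final t x r) ≡ true →
      ∀ {k i} → clause k x ≡ false → i ∈ Scp k → Touched t x r i
    violated⇒touched zero    x z       Φx {k} k-bad i∈k = contradiction k-bad (Φ⇒clause Φx k)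
    violated⇒touched (suc t) x (w , r) Φf {k} {i} k-bad i∈k with scope-view x
    ... | inj₁ (Φx , _) = contradiction k-bad (Φ⇒clause Φx k)
    ... | inj₂ (ℓ , ℓ-bad , scope≡)
      with violation-persists {x′ = next x w} k-bad ℓ-bad
        (λ j j∉ℓ → ≡.sym (next-∉ x w (j∉ℓ ∘ ≡.subst (j ∈_) scope≡)))
    ...   | inj₁ ≡.refl                 = inj₁ (≡.subst (i ∈_) (≡.sym scope≡) i∈k)
    ...   | inj₂ (k′ , k⊆k′ , k′-bad) = inj₂ (violated⇒touched t (next x w) r Φf k′-bad (k⊆k′ i∈k))

    -- Only the last value drawn for an index is exchanged, and the initial value of an index
    -- resampled later is not the last.
    exchange-touched : ∀ t x r {i} → Touched t x r i → proj₁ (exchange t (x , r)) i ≡ x i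
    exchange-touched (suc t) x (w , r) {i} touched with i ∈? scope x
    ... | yes _   = ≡.refl
    ... | no  i∉S with touched
    ...   | inj₁ i∈S = contradiction i∈S i∉S
    ...   | inj₂ later = ≡.trans (exchange-touched t (next x w) r later) (next-∉ x w i∉S)

    module _ t x r (Φ-final : Φ (final t x r) ≡ true) where
      -- A clause violated by either state has only touched indices in its scope, and there the two
      -- states agree; hence it is violated by both.
      same-clauses : (∀ {k i} → clause k (proj₁ (exchange t (x , r))) ≡ false → i ∈ Scp k → Touched t x r i) →
        ∀ k → clause k (proj₁ (exchange t (x , r))) ≡ clause k x
      same-clauses touched k with clause k x in eq | clause k (proj₁ (exchange t (x , r))) in eq′
      ... | true  | true  = ≡.refl
      ... | false | false = ≡.refl
      ... | true  | false = ≡.trans (≡.sym eq′) (≡.trans (clause-local k _ x λ i i∈k →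
        exchange-touched t x r (touched eq′ i∈k)) eq)
      ... | false | true  = ≡.trans (≡.sym eq′) (≡.trans (clause-local k _ x λ i i∈k →
        exchange-touched t x r (violated⇒touched t x r Φ-final eq i∈k)) eq)

    exchange-violated⇒touched : ∀ t x r → Φ (final t x r) ≡ true → Φ (unused t r) ≡ true →
      ∀ {k i} → clause k (proj₁ (exchange t (x , r))) ≡ false → i ∈ Scp k → Touched t x r i
    exchange-violated⇒touched zero    x z       Φx Φz {k} k-bad i∈k = contradiction k-bad (Φ⇒clause Φz k)
    exchange-violated⇒touched (suc t) x (w , r) Φf Φu {k} {i} k-bad i∈k with scope-view x
    ... | inj₁ (Φx , scope≡) = inj₂ (exchange-violated⇒touched t (next x w) r Φf Φu
      (≡.trans (clause-cong k λ j → ≡.sym (splice-∉ x (proj₁ (exchange t (next x w , r)))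
        (≡.subst (j ∉_) (≡.sym scope≡) ∉⊥))) k-bad) i∈k)
    ... | inj₂ (ℓ , ℓ-bad , scope≡)
      with violation-persists {x′ = proj₁ (exchange t (next x w , r))} k-bad
        (≡.trans (clause-local ℓ _ x λ j j∈ℓ →
          splice-∈ x (proj₁ (exchange t (next x w , r))) (≡.subst (j ∈_) (≡.sym scope≡) j∈ℓ)) ℓ-bad)
        (λ j j∉ℓ → splice-∉ x (proj₁ (exchange t (next x w , r))) (j∉ℓ ∘ ≡.subst (j ∈_) scope≡))
    ...   | inj₁ ≡.refl                 = inj₁ (≡.subst (i ∈_) (≡.sym scope≡) i∈k)
    ...   | inj₂ (k′ , k⊆k′ , k′-bad) =
      inj₂ (exchange-violated⇒touched t (next x w) r Φf Φu k′-bad (k⊆k′ i∈k))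

    scope-exchange : ∀ t x r → Φ (final t x r) ≡ true → Φ (unused t r) ≡ true →
      scope (proj₁ (exchange t (x , r))) ≡ scope x
    scope-exchange t x r Φf Φu =
      scope-≡ (same-clauses t x r Φf (exchange-violated⇒touched t x r Φf Φu))

    reverse : Reversible Φ
    reverse zero    x z       Φf Φu = ((λ _ → ≡.refl) , λ _ → ≡.refl) , λ _ → ≡.refl
    reverse (suc t) x (w , r) Φf Φu =
      let S = scope x
          (y , r′) = exchange t (next x w , r)
          x′ = splice S x y
          w′ = splice S y w
          -- Equality of the scopes is what makes `splice` undo itself coordinate by coordinate.
          S′≡S : scope x′ ≡ S
          S′≡S = scope-exchange (suc t) x (w , r) Φf Φu
          -- Off `S` the state `x′` already carries `y`, and on `S` the sample `w′` supplies it.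
          -- After one iteration the exchanged run therefore continues as the exchange of the
          -- remaining run.
          next≐y : next x′ w′ ≐ y
          next≐y i = ≡.trans
            (splice-cong S′≡S {v = w′} {w = w′} {x = x′} {y = x′} (λ _ → ≡.refl) (λ _ → ≡.refl) i)
            (back S x y w i)
          y″ = proj₁ (exchange t (next x′ w′ , r′))
          r′-refl = Setoid.refl (Draws t) {r′}
          ((y≐ , r≈) , final≐) = reverse t (next x w) r Φf Φu
          (y″≐ , r″≈) = exchange-cong t {next x′ w′ , r′} {y , r′} (next≐y , r′-refl)
          y″≐next i = ≡.trans (y″≐ i) (y≐ i)
      in ( (λ i → ≡.trans (splice-cong S′≡S {v = x′} {w = x′} {x = y″} (λ _ → ≡.refl) y″≐next i)
                          (undo S x w y i))
         , (λ i → ≡.trans (splice-cong S′≡S {v = y″} {x = w′} {y = w′} y″≐next (λ _ → ≡.refl) i)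
                          (redo S x w y i))
         , Setoid.trans (Draws t) r″≈ r≈)
         , λ i → ≡.trans (final-cong t {next x′ w′} {y} {r′} {r′} next≐y r′-refl i) (final≐ i)
      where
      back : ∀ S (x y w : Assignment) → splice S (splice S y w) (splice S x y) ≐ y
      back S x y w i with does (i ∈? S)
      ... | true  = ≡.refl
      ... | false = ≡.refl
      undo : ∀ S (x w y : Assignment) → splice S (splice S x y) (splice S w x) ≐ x
      undo S x w y i with does (i ∈? S)
      ... | true  = ≡.refl
      ... | false = ≡.refl
      redo : ∀ S (x w y : Assignment) → splice S (splice S w x) (splice S y w) ≐ w
      redo S x w y i with does (i ∈? S)
      ... | true  = ≡.refl
      ... | false = ≡.refl

-- The algorithm as an instance of the resampling process

module PartialRejectionSampling {n m} (I : Instance n m) (f : Choice m) where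
  open Instance I hiding (_≟_; resample)
  open Clauses I f
  open ProductDistribution ℝ-∑-semiring using (Family)

  family : Family n
  family = record
    { D = D ; _≟_ = λ {i} → Instance._≟_ I {i} ; μ = λ i → mass (dist i) ; total = λ i → total (dist i) }

  open Resampling ℝ-∑-semiring family scope scope-cong public

  step-resample : ∀ x y → step I f x y ≈ resample (scope x) x y
  step-resample x y with nonempty? (violated x)
  ... | yes _ = (λ _ q< → q<) , (λ _ q< → q<)
  ... | no  _ = resample-⊥ x y

  open Law (step I f) (law I f) step-resample
    (λ _ → (λ _ q< → q<) , (λ _ q< → q<)) (λ _ _ → (λ _ q< → q<) , (λ _ q< → q<)) public

⊗-congˡ : ∀ w x y → w ≈ x → w ⊗ y ≈ x ⊗ y
⊗-congˡ w x y w≈x = ⊗-cong {w} {x} {y} {y} w≈x ((λ _ q< → q<) , (λ _ q< → q<))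

⨆-cong : ∀ (x y : ℕ → ℝ≥0∞) → (∀ t → x t ≈ y t) → ⨆ x ≈ ⨆ y
⨆-cong x y eq = (λ q (t , q<) → t , proj₁ (eq t) q q<) , (λ q (t , q<) → t , proj₂ (eq t) q q<)

⨆-⊗ : ∀ (x : ℕ → ℝ≥0∞) y → ⨆ x ⊗ y ≈ ⨆ (λ t → x t ⊗ y)
⨆-⊗ x y = (λ where
    q (inj₁ q<0) → 0 , inj₁ q<0
    q (inj₂ (r , s , 0≤r , 0≤s , (t , r<x) , s<y , q<rs)) → t , inj₂ (r , s , 0≤r , 0≤s , r<x , s<y , q<rs))
  , (λ where
    q (t , inj₁ q<0) → inj₁ q<0
    q (t , inj₂ (r , s , 0≤r , 0≤s , r<x , s<y , q<rs)) → inj₂ (r , s , 0≤r , 0≤s , (t , r<x) , s<y , q<rs))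

theorem5 : ∀ {n m} (I : Instance n m) (_∼_ : Rel (Fin m) 0ℓ) →
    Positive (Instance.Pr I (Instance.𝒟 I) (Instance.Φ I)) →
    IsDependencyRelation I _∼_ → Axiom1 I _∼_ → Axiom2 I _∼_ →
    (f : Choice m) →
    (PrTerminates I f ≈ 𝟙) ×
    ((A : Instance.Assignment I → Bool) → A Preserves Instance._≐_ I ⟶ _≡_ →
    PrOutput I f A ≈ Instance.𝒟-given-Φ I A)
theorem5 {n} I _∼_ Φ-positive _ axiom1 axiom2 f = terminates , conditional
  where
  module P = PartialRejectionSampling I f
  open Instance I
  open Clauses I f
  open SetoidReasoning (CommutativeSemiring.setoid ℝ-commutativeSemiring)

  satisfying : ∃[ z ] Positive (𝒟 z ⊗ ⟦ Φ z ⟧)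
  satisfying = positive-term assignments _ Φ-positive
  z = proj₁ satisfying

  𝒟z-positive : Positive (𝒟 z)
  𝒟z-positive = proj₁ (positive-⊗⁻ (𝒟 z) ⟦ Φ z ⟧ (proj₂ satisfying))

  Φz : Φ z ≡ true
  Φz = positive-⟦⟧ (Φ z) (proj₂ (positive-⊗⁻ (𝒟 z) ⟦ Φ z ⟧ (proj₂ satisfying)))
    where
    positive-⟦⟧ : ∀ b → Positive ⟦ b ⟧ → b ≡ true
    positive-⟦⟧ true  _   = ≡.refl
    positive-⟦⟧ false 0<0 = contradiction 0<0 (ℚ.<-irrefl ≡.refl)

  power-positive : ∀ k → Positive (P.power (𝒟 z) k)
  power-positive zero    = ℚ.positive⁻¹ 1ℚ
  power-positive (suc k) = positive-⊗ (𝒟 z) (P.power (𝒟 z) k) 𝒟z-positive (power-positive k)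

  a b : ℕ → ℝ≥0∞
  a = P.accepted Φ Φ-cong
  b = P.rejected Φ Φ-cong

  terminates : PrTerminates I f ≈ 𝟙
  terminates = begin
    PrTerminates I f  ≈⟨ ⨆-cong (λ t → Pr (law I f t) Φ) a (λ t → P.law-Bool t Φ-cong) ⟩
    ⨆ a               ≈⟨ ⨆a≈𝟙 a b (P.power (𝒟 z) n) n (power-positive n) (P.accepted+rejected≈1 Φ Φ-cong)
                           (P.accepted-progress Φ Φ-cong absorbing z n (reaches z Φz)) ⟩
    𝟙                 ∎

  module _ (A : Assignment → Bool) (A-cong : A Preserves _≐_ ⟶ _≡_) where
    AΦ : Assignment → Bool
    AΦ x = A x ∧ Φ x

    AΦ-cong : AΦ Preserves _≐_ ⟶ _≡_
    AΦ-cong x≐y = ≡.cong₂ _∧_ (A-cong x≐y) (Φ-cong x≐y)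

    proportional : ∀ t → Pr (law I f t) AΦ ⊗ Pr 𝒟 Φ ≈ Pr (law I f t) Φ ⊗ Pr 𝒟 AΦ
    proportional t = begin
      Pr (law I f t) AΦ ⊗ Pr 𝒟 Φ
        ≈⟨ ⊗-congˡ (Pr (law I f t) AΦ) (P.Pr-after t AΦ) (Pr 𝒟 Φ) (P.law-Bool t AΦ-cong) ⟩
      P.Pr-after t AΦ ⊗ Pr 𝒟 Φ
        ≈⟨ P.exchange-≈ Φ Φ-cong (reverse _∼_ axiom1 axiom2) AΦ-cong Φ-cong
             (λ x Φx → ≡.trans (≡.cong (A x ∧_) Φx) (Bool.∧-zeroʳ (A x))) (λ _ Φx → Φx) t ⟩
      P.Pr-after t Φ ⊗ Pr 𝒟 AΦ
        ≈⟨ ⊗-congˡ (Pr (law I f t) Φ) (P.Pr-after t Φ) (Pr 𝒟 AΦ) (P.law-Bool t Φ-cong) ⟨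
      Pr (law I f t) Φ ⊗ Pr 𝒟 AΦ ∎

    -- The proportionality at each time passes to the supremum, where termination replaces the
    -- acceptance probability by 1.
    conditional : PrOutput I f A ≈ 𝒟-given-Φ A
    -- At time 0 the accepted mass is `Pr 𝒟 Φ` itself, so `b 0` is the complement that locates the
    -- divisor.
    conditional = ⊗⇒⊘ {PrOutput I f A} {Pr 𝒟 AΦ} {Pr 𝒟 Φ} {b 0} Φ-positive
      (P.accepted+rejected≈1 Φ Φ-cong 0) (begin
        PrOutput I f A ⊗ Pr 𝒟 Φ
          ≈⟨ ⨆-⊗ (λ t → Pr (law I f t) AΦ) (Pr 𝒟 Φ) ⟩
        ⨆ (λ t → Pr (law I f t) AΦ ⊗ Pr 𝒟 Φ)
          ≈⟨ ⨆-cong (λ t → Pr (law I f t) AΦ ⊗ Pr 𝒟 Φ) (λ t → Pr (law I f t) Φ ⊗ Pr 𝒟 AΦ) proportional ⟩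
        ⨆ (λ t → Pr (law I f t) Φ ⊗ Pr 𝒟 AΦ)
          ≈⟨ ⨆-⊗ (λ t → Pr (law I f t) Φ) (Pr 𝒟 AΦ) ⟨
        PrTerminates I f ⊗ Pr 𝒟 AΦ
          ≈⟨ ⊗-congˡ (PrTerminates I f) 𝟙 (Pr 𝒟 AΦ) terminates ⟩
        𝟙 ⊗ Pr 𝒟 AΦ
          ≈⟨ ⊗-identity (Pr 𝒟 AΦ) ⟩
        Pr 𝒟 AΦ ∎)
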